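{- For every $\varepsilon>0$, the integrality gap of the cluster LP is at least $4/3-\varepsilon$; that is, there exists a Correlation Clustering instance whose optimum clustering cost $\mathrm{opt}$ satisfies $\mathrm{opt}\ge(4/3-\varepsilon)\cdot\mathrm{LP}^*$, where $\mathrm{LP}^*>0$ is the optimum value of the cluster LP for that instance.
   Context: A Correlation Clustering instance consists of a finite vertex set $V$ and a partition $E^+\uplus E^-=\binom V2$ of the unordered pairs of distinct vertices into $+$edges and $-$edges. A clustering is a partition of $V$; its cost is the number of $+$edges whose endpoints lie in different parts plus the number of $-$edges whose endpoints lie in the same part; $\mathrm{opt}$ is the minimum cost. For $x\in[0,1]^{\binom V2}$, $\mathrm{obj}(x)=\sum_{uv\in E^+}x_{uv}+\sum_{uv\in E^- }(1-x_{uv})$. The cluster LP has a variable $z_S$ for every nonempty $S\subseteq V$ and $x_{uv}$ for every $uv\in\binom V2$; it minimizes $\mathrm{obj}(x)$ subject to $\sum_{S\ni u}z_S=1$ for all $u$, $\sum_{S\supseteq\{u,v\}}z_S=1-x_{uv}$ for all $uv$, and $z_S\ge0$. The integrality gap is the supremum over instances of $\mathrm{opt}$ divided by the optimum LP value.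
   Formalization: Here ε, the variables z and x of the cluster LP, and LP* are rational, so LP* is the minimum over rational feasible points; since the LP has rational data, this equals its optimum over the reals. -}

module Defs where

open import Data.Fin.Base using (Fin; _<_)
open import Data.Fin.Properties using (_<?_)
open import Data.Fin.Subset using (Subset; inside; outside; _∈_; _∩_; Nonempty; Empty)
open import Data.Fin.Subset.Properties using (_∈?_)
open import Data.List.Base
  using (List; []; _∷_; [_]; _++_; map; mapMaybe; filter; foldr; length; allFin; cartesianProduct)
open import Data.List.Relation.Unary.All using (All)
open import Data.List.Relation.Unary.AllPairs using (AllPairs)
open import Data.List.Relation.Unary.Any using (Any; any?)
import Data.Maybe.Base as Maybe
open import Data.Nat.Base as ℕ using (ℕ; zero; suc)
open import Data.Product.Base using (_×_; _,_; ∃-syntax)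
open import Data.Rational.Base as ℚ using (ℚ; 0ℚ; 1ℚ)
open import Data.Sign.Base as Sign using (Sign)
open import Data.Sign.Properties using (_≟_)
import Data.Vec.Base as Vec
open import Relation.Binary.PropositionalEquality.Core using (_≡_)
open import Relation.Nullary.Decidable using (Dec; dec⇒maybe; ¬?; _×-dec_)

private
  variable
    n : ℕ

sumOver : {A : Set} → List A → (A → ℚ) → ℚ
sumOver xs f = foldr ℚ._+_ 0ℚ (map f xs)

-- An unordered pair of distinct elements of Fin n, listed in increasing order.
record Edge (n : ℕ) : Set where
  constructor edge
  field
    src tgt  : Fin n
    .src<tgt : src < tgt

open Edge public

edges : ∀ n → List (Edge n)
edges n = mapMaybe toEdge (cartesianProduct (allFin n) (allFin n))
  where
  toEdge : Fin n × Fin n → Maybe.Maybe (Edge n)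
  toEdge (u , v) = Maybe.map (λ u<v → edge u v u<v) (dec⇒maybe (u <? v))

subsets : ∀ n → List (Subset n)
subsets zero    = [ Vec.[] ]
subsets (suc n) = map (Vec._∷_ outside) (subsets n) ++ map (Vec._∷_ inside) (subsets n)

_⊆ᵉ_ : Edge n → Subset n → Set
e ⊆ᵉ S = src e ∈ S × tgt e ∈ S

_⊆ᵉ?_ : (e : Edge n) (S : Subset n) → Dec (e ⊆ᵉ S)
e ⊆ᵉ? S = (src e ∈? S) ×-dec (tgt e ∈? S)

-- A Correlation Clustering instance: the vertex set is Fin vertices, and
-- the partition of the edges into E⁺ and E⁻ is given by their signs.
record Instance : Set where
  field
    vertices : ℕ
    sign     : Edge vertices → Sign

  E⁺ E⁻ : List (Edge vertices)
  E⁺ = filter (λ e → sign e ≟ Sign.+) (edges vertices)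
  E⁻ = filter (λ e → sign e ≟ Sign.-) (edges vertices)

open Instance public

record Clustering (n : ℕ) : Set where
  field
    parts    : List (Subset n)
    nonempty : All Nonempty parts
    disjoint : AllPairs (λ S T → Empty (S ∩ T)) parts
    covering : ∀ u → Any (u ∈_) parts

open Clustering public

SamePart : Clustering n → Edge n → Set
SamePart C e = Any (e ⊆ᵉ_) (parts C)

samePart? : (C : Clustering n) (e : Edge n) → Dec (SamePart C e)
samePart? C e = any? (e ⊆ᵉ?_) (parts C)

cost : (I : Instance) → Clustering (vertices I) → ℕ
cost I C = length (filter (λ e → ¬? (samePart? C e)) (E⁺ I))
     ℕ.+ length (filter (samePart? C) (E⁻ I))

IsOpt : Instance → ℕ → Set
IsOpt I opt = (∃[ C ] cost I C ≡ opt) × (∀ C → opt ℕ.≤ cost I C)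

obj : (I : Instance) → (Edge (vertices I) → ℚ) → ℚ
obj I x = sumOver (E⁺ I) x ℚ.+ sumOver (E⁻ I) (λ e → 1ℚ ℚ.- x e)

-- The LP has a variable z S only for nonempty S.  The value of z at the empty
-- set is a dummy: it occurs in no constraint and not in the objective.
-- The bounds 0 ≤ x e ≤ 1 follow from the constraints.
record ClusterLPFeasible (n : ℕ) (z : Subset n → ℚ) (x : Edge n → ℚ) : Set where
  field
    vertexConstraint : ∀ u → sumOver (filter (u ∈?_) (subsets n)) z ≡ 1ℚ
    edgeConstraint   : ∀ e → sumOver (filter (e ⊆ᵉ?_) (subsets n)) z ≡ 1ℚ ℚ.- x e
    nonnegative      : ∀ S → Nonempty S → 0ℚ ℚ.≤ z S

-- All LP data are rational, so the optimum over the reals is rational and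
-- attained at a rational point: restricting to ℚ does not change the optimum.
IsClusterLPOptimum : Instance → ℚ → Set
IsClusterLPOptimum I val =
    (∃[ z ] ∃[ x ] ClusterLPFeasible (vertices I) z x × obj I x ≡ val)
  × (∀ z x → ClusterLPFeasible (vertices I) z x → val ℚ.≤ obj I x)

-- Let n be large and take the edges of Kₙ as vertices, joined by a +edge when they
-- share an endpoint.  Giving weight 1/2 to each star of Kₙ cuts every +edge to the
-- extent 1/2 and separates all -edges, at total cost n(n-1)(n-2)/4; summing the bad
-- triangle inequalities of (ab, bc, cd) over all paths abcd shows that this is optimal.
-- In a clustering, each triangle of Kₙ that is not monochromatic has at least two of
-- its three +edges cut.  An edge in t monochromatic triangles lies in a part with t(t-1) ordered
-- pairs of disjoint edges ac, bd, so monochromatic triangles are paid for by -edges,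
-- up to O(n²), and the cost is at least n(n-1)(n-2)/3 - O(n²).
module Submission where

open import Defs

open import Algebra.Bundles using (CommutativeRing)
open import Data.Bool.Base using (Bool; true; false; if_then_else_; _∧_; _∨_; not)
import Data.Bool.Properties as Bool
open import Data.Fin.Base as Fin using (Fin; zero; suc; _↑ˡ_; _↑ʳ_; splitAt)
open import Data.Fin.Properties as Fin
  using (_≟_; splitAt-↑ˡ; splitAt-↑ʳ; _<?_; <-cmp; suc-injective)
open import Data.Fin.Subset using (Subset; inside; outside; _∩_; Nonempty; Empty; ⊤)
  renaming (_∈_ to _∈ˢ_)
open import Data.Fin.Subset.Properties using (nonempty?; ∈⊤; ∩-comm; x∈p∩q⁺)
  renaming (_∈?_ to _∈ˢ?_)
import Data.Integer.Base as ℤ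
import Data.Integer.Properties as ℤ
open import Data.List.Base using
  (List; []; _∷_; _++_; map; mapMaybe; filter; length; tabulate; allFin; cartesianProduct)
open import Data.List.Extrema.Nat using (argmin; argmin-all; f[argmin]≤v⁺)
import Data.List.Membership.DecPropositional as DecMembership
open import Data.List.Membership.Propositional using (_∈_; find; lose)
open import Data.List.Membership.Propositional.Properties
  using (∈-map⁺; ∈-map⁻; ∈-++⁺ˡ; ∈-++⁺ʳ; ∈-filter⁺; ∈-filter⁻)
open import Data.List.Properties using (filter-≐)
open import Data.List.Relation.Unary.All as All using (All; []; _∷_)
open import Data.List.Relation.Unary.All.Properties using (all-filter)
open import Data.List.Relation.Unary.AllPairs as AllPairs using (AllPairs; []; _∷_)
open import Data.List.Relation.Unary.Any as Any using (Any; here; there; any?)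
open import Data.List.Relation.Unary.Unique.Propositional using (Unique)
import Data.List.Relation.Unary.Unique.Propositional.Properties as Unique
open import Data.Maybe.Base as Maybe using (Maybe; just; nothing; maybe′)
open import Data.Nat.Base as ℕ using (ℕ; zero; suc; s≤s; z≤n)
import Data.Nat.Coprimality as Coprimality
import Data.Nat.Properties as ℕ
open import Data.Product.Base as Product using (_×_; _,_; proj₁; proj₂; ∃-syntax)
open import Data.Rational.Base using
  ( ℚ; mkℚ; 0ℚ; 1ℚ; ½; _+_; _*_; _-_; -_; 1/_; _/_; _≤_; _<_; _≥_; *<*; *≤*
  ; nonNegative; positive )
import Data.Rational.Properties as ℚ
open import Data.Rational.Solver using (module +-*-Solver)
open import Data.Sign.Base as Sign using (Sign)
import Data.Sign.Properties as Sign
open import Data.Sum.Base as Sum using (_⊎_; inj₁; inj₂; [_,_]′)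
import Data.Vec.Base as Vec
import Data.Vec.Properties as Vec
open import Function.Base using (id; _∘_)
open import Function.Bundles using (mk⇔)
open import Relation.Binary.Definitions using (tri<; tri≈; tri>)
open import Relation.Binary.PropositionalEquality
open import Relation.Nullary.Decidable using
  (Dec; yes; no; does; toWitness; _×-dec_; _⊎-dec_; ¬?; does-⇔; dec-true; dec-false; dec⇒maybe)
open import Relation.Nullary.Negation using (contradiction)
open import Relation.Unary using (Decidable)

import Algebra.Properties.Semiring.Sum (CommutativeRing.semiring ℚ.+-*-commutativeRing) as ∑ℚ
open +-*-Solver using (solve; con; _:=_; _:+_; _:*_; _:-_; :-_)

-- Two edges of Kₙ with a common endpoint span exactly one triangle, so every +edge belongs to one
-- triangle and costs can be compared per triangle: the half-weighted stars pay 3/2, and a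
-- clustering pays at least 2 for each triangle that is not monochromatic. This is the source of
-- 4/3. The obstacle is the monochromatic triangle, which pays nothing for its +edges. It can be
-- charged only to the -edges of its part, and the charge has to be bounded linearly in the number
-- of such triangles. Both cost functions are expressed through one kernel `K`, the extent to which
-- two edges of Kₙ are joined. All sums run over full tuples of vertices of Kₙ, with distinctness as
-- a 0/1 factor. Each cost is then `½ * (∑₃ D₃ - ∑⁺ K) + 1/8 * ∑⁻ K`, and both lower bounds become
-- linear combinations of a few inequalities between `∑⁺ K`, `∑⁻ K` and constants.

private
  variable
    n : ℕ

-- Rational arithmetic and sums over `Fin n`

2ℚ 3ℚ 4ℚ : ℚ
2ℚ = ℤ.+ 2 / 1
3ℚ = ℤ.+ 3 / 1
4ℚ = ℤ.+ 4 / 1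

-- The form of all longer estimates: `r` is an explicit nonnegative slack, and the equation is left
-- to the ring solver.
≤-by : ∀ {x y} r → 0ℚ ≤ r → x + r ≡ y → x ≤ y
≤-by {x} r 0≤r refl = subst (_≤ x + r) (ℚ.+-identityʳ x) (ℚ.+-monoʳ-≤ x 0≤r)

0≤+ : ∀ {x y} → 0ℚ ≤ x → 0ℚ ≤ y → 0ℚ ≤ x + y
0≤+ = ℚ.+-mono-≤

0≤* : ∀ {x y} → 0ℚ ≤ x → 0ℚ ≤ y → 0ℚ ≤ x * y
0≤* {x} {y} 0≤x 0≤y = subst (_≤ x * y) (ℚ.*-zeroʳ x) (ℚ.*-monoˡ-≤-nonNeg x {{nonNegative 0≤x}} 0≤y)

0≤- : ∀ {x y} → x ≤ y → 0ℚ ≤ y - x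
0≤- {x} {y} x≤y = subst (_≤ y - x) (ℚ.+-inverseʳ x) (ℚ.+-monoˡ-≤ (- x) x≤y)

𝟙 : Bool → ℚ
𝟙 b = if b then 1ℚ else 0ℚ

0≤𝟙 : ∀ b → 0ℚ ≤ 𝟙 b
0≤𝟙 true  = ℚ.nonNegative⁻¹ 1ℚ
0≤𝟙 false = ℚ.≤-refl

-- Distinctness enters as the factor `w` instead of a restriction of the index set, so that
-- summation variables can be exchanged and renamed freely.
δ w : Fin n → Fin n → ℚ
δ i j = 𝟙 (does (i ≟ j))
w i j = 1ℚ - δ i j

0≤w : ∀ (i j : Fin n) → 0ℚ ≤ w i j
0≤w i j with does (i ≟ j)
... | true  = ℚ.≤-refl
... | false = ℚ.nonNegative⁻¹ 1ℚ

δ-sym : ∀ (i j : Fin n) → δ i j ≡ δ j i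
δ-sym i j with i ≟ j | j ≟ i
... | yes _ | yes _   = refl
... | no _  | no _    = refl
... | yes p | no ¬p   with () ← ¬p (sym p)
... | no ¬p | yes p   with () ← ¬p (sym p)

w-sym : ∀ (i j : Fin n) → w i j ≡ w j i
w-sym i j = cong (λ x → 1ℚ - x) (δ-sym i j)

w-δδ : ∀ (i j k : Fin n) → w i j * (δ i k * δ j k) ≡ 0ℚ
w-δδ i j k with i ≟ j | i ≟ k | j ≟ k
... | yes _ | yes _ | yes _ = refl
... | yes _ | yes _ | no _  = refl
... | yes _ | no _  | yes _ = refl
... | yes _ | no _  | no _  = refl
... | no i≢j | yes refl | yes refl with () ← i≢j refl
... | no _  | yes _ | no _  = refl
... | no _  | no _  | yes _ = refl
... | no _  | no _  | no _  = refl

-- Opaque, so that unification can read off the summand of a sum.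
opaque
  sum : (Fin n → ℚ) → ℚ
  sum = ∑ℚ.sum

  sum-cong-≗ : ∀ {f g : Fin n → ℚ} → f ≗ g → sum f ≡ sum g
  sum-cong-≗ = ∑ℚ.sum-cong-≗

  ∑-comm : ∀ {m} (f : Fin m → Fin n → ℚ) → sum (λ i → sum (f i)) ≡ sum (λ j → sum (λ i → f i j))
  ∑-comm f = ∑ℚ.∑-comm f

  ∑-distrib-+ : ∀ (f g : Fin n → ℚ) → sum (λ i → f i + g i) ≡ sum f + sum g
  ∑-distrib-+ = ∑ℚ.∑-distrib-+

  *-distribˡ-sum : ∀ x (f : Fin n → ℚ) → x * sum f ≡ sum (λ i → x * f i)
  *-distribˡ-sum = ∑ℚ.*-distribˡ-sum

  *-distribʳ-sum : ∀ x (f : Fin n → ℚ) → sum f * x ≡ sum (λ i → f i * x)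
  *-distribʳ-sum = ∑ℚ.*-distribʳ-sum

  sum-mono : ∀ {f g : Fin n → ℚ} → (∀ i → f i ≤ g i) → sum f ≤ sum g
  sum-mono {zero}  f≤g = ℚ.≤-refl
  sum-mono {suc n} f≤g = ℚ.+-mono-≤ (f≤g zero) (sum-mono (λ i → f≤g (suc i)))

  sum-nonneg : ∀ {f : Fin n → ℚ} → (∀ i → 0ℚ ≤ f i) → 0ℚ ≤ sum f
  sum-nonneg {zero}  0≤f = ℚ.≤-refl
  sum-nonneg {suc n} 0≤f = 0≤+ (0≤f zero) (sum-nonneg (λ i → 0≤f (suc i)))

  sum-zero : ∀ {f : Fin n → ℚ} → (∀ i → f i ≡ 0ℚ) → sum f ≡ 0ℚ
  sum-zero {zero}  f≡0 = refl
  sum-zero {suc n} f≡0 = cong₂ _+_ (f≡0 zero) (sum-zero (λ i → f≡0 (suc i)))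

  sum-sub : ∀ (f g : Fin n → ℚ) → sum (λ i → f i - g i) ≡ sum f - sum g
  sum-sub {zero}  f g = refl
  sum-sub {suc n} f g = trans (cong ((f zero - g zero) +_) (sum-sub (λ i → f (suc i)) (λ i → g (suc i))))
    (solve 4 (λ a b c d → (a :- b) :+ (c :- d) := (a :+ c) :- (b :+ d)) refl
      (f zero) (g zero) (sum (λ i → f (suc i))) (sum (λ i → g (suc i))))

  δ-sum : ∀ i (f : Fin n → ℚ) → sum (λ j → δ i j * f j) ≡ f i
  δ-sum {suc n} zero f = trans
    (cong₂ _+_ (ℚ.*-identityˡ (f zero)) (sum-zero {n} (λ i → ℚ.*-zeroˡ (f (suc i)))))
    (ℚ.+-identityʳ (f zero))
  δ-sum {suc n} (suc i) f = trans
    (cong₂ _+_ (ℚ.*-zeroˡ (f zero)) (δ-sum i (λ j → f (suc j))))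
    (ℚ.+-identityˡ (f (suc i)))

  sum-suc : ∀ (f : Fin (suc n) → ℚ) → sum f ≡ f zero + sum (λ i → f (suc i))
  sum-suc f = refl

  sum-++ : ∀ m (f : Fin (m ℕ.+ n) → ℚ) → sum f ≡ sum (λ i → f (i ↑ˡ n)) + sum (λ i → f (m ↑ʳ i))
  sum-++ zero    f = sym (ℚ.+-identityˡ (sum f))
  sum-++ (suc m) f = trans (cong (f zero +_) (sum-++ m (λ i → f (suc i)))) (sym (ℚ.+-assoc (f zero) _ _))

  sumOver-tabulate : ∀ {A : Set} (g : Fin n → A) (f : A → ℚ) → sumOver (tabulate g) f ≡ sum (λ i → f (g i))
  sumOver-tabulate {zero}  g f = refl
  sumOver-tabulate {suc n} g f = cong (f (g zero) +_) (sumOver-tabulate (λ i → g (suc i)) f)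

-- The rational number `n`, in the form in which counting produces it.
ν : ℕ → ℚ
ν n = sum {n} (λ _ → 1ℚ)

sum-δ : ∀ (i : Fin n) → sum (δ i) ≡ 1ℚ
sum-δ i = trans (sum-cong-≗ (λ j → sym (ℚ.*-identityʳ (δ i j)))) (δ-sum i (λ _ → 1ℚ))

∑₂ : (Fin n → Fin n → ℚ) → ℚ
∑₂ f = sum (λ a → sum (f a))

∑₃ : (Fin n → Fin n → Fin n → ℚ) → ℚ
∑₃ f = sum (λ a → ∑₂ (f a))

∑₄ : (Fin n → Fin n → Fin n → Fin n → ℚ) → ℚ
∑₄ f = sum (λ a → ∑₃ (f a))

∑₂-cong : {f g : Fin n → Fin n → ℚ} → (∀ a b → f a b ≡ g a b) → ∑₂ f ≡ ∑₂ g
∑₂-cong f≡g = sum-cong-≗ (λ a → sum-cong-≗ (f≡g a))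

∑₃-cong : {f g : Fin n → Fin n → Fin n → ℚ} → (∀ a b c → f a b c ≡ g a b c) → ∑₃ f ≡ ∑₃ g
∑₃-cong f≡g = sum-cong-≗ (λ a → ∑₂-cong (f≡g a))

∑₄-cong : {f g : Fin n → Fin n → Fin n → Fin n → ℚ} →
          (∀ a b c d → f a b c d ≡ g a b c d) → ∑₄ f ≡ ∑₄ g
∑₄-cong f≡g = sum-cong-≗ (λ a → ∑₃-cong (f≡g a))

∑₂-+ : (f g : Fin n → Fin n → ℚ) → ∑₂ (λ a b → f a b + g a b) ≡ ∑₂ f + ∑₂ g
∑₂-+ f g = trans (sum-cong-≗ (λ a → ∑-distrib-+ (f a) (g a))) (∑-distrib-+ _ _)

∑₃-+ : (f g : Fin n → Fin n → Fin n → ℚ) → ∑₃ (λ a b c → f a b c + g a b c) ≡ ∑₃ f + ∑₃ g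
∑₃-+ f g = trans (sum-cong-≗ (λ a → ∑₂-+ (f a) (g a))) (∑-distrib-+ _ _)

∑₄-+ : (f g : Fin n → Fin n → Fin n → Fin n → ℚ) →
       ∑₄ (λ a b c d → f a b c d + g a b c d) ≡ ∑₄ f + ∑₄ g
∑₄-+ f g = trans (sum-cong-≗ (λ a → ∑₃-+ (f a) (g a))) (∑-distrib-+ _ _)

∑₂-* : ∀ x (f : Fin n → Fin n → ℚ) → ∑₂ (λ a b → x * f a b) ≡ x * ∑₂ f
∑₂-* x f = trans (sum-cong-≗ (λ a → sym (*-distribˡ-sum x (f a)))) (sym (*-distribˡ-sum x _))

∑₃-* : ∀ x (f : Fin n → Fin n → Fin n → ℚ) → ∑₃ (λ a b c → x * f a b c) ≡ x * ∑₃ f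
∑₃-* x f = trans (sum-cong-≗ (λ a → ∑₂-* x (f a))) (sym (*-distribˡ-sum x _))

∑₃-sub : (f g : Fin n → Fin n → Fin n → ℚ) → ∑₃ (λ a b c → f a b c - g a b c) ≡ ∑₃ f - ∑₃ g
∑₃-sub f g = trans (sum-cong-≗ (λ a → trans (sum-cong-≗ (λ b → sum-sub (f a b) (g a b))) (sum-sub _ _))) (sum-sub _ _)

∑₂-mono : {f g : Fin n → Fin n → ℚ} → (∀ a b → f a b ≤ g a b) → ∑₂ f ≤ ∑₂ g
∑₂-mono f≤g = sum-mono (λ a → sum-mono (f≤g a))

∑₃-mono : {f g : Fin n → Fin n → Fin n → ℚ} → (∀ a b c → f a b c ≤ g a b c) → ∑₃ f ≤ ∑₃ g
∑₃-mono f≤g = sum-mono (λ a → ∑₂-mono (f≤g a))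

∑₄-mono : {f g : Fin n → Fin n → Fin n → Fin n → ℚ} →
          (∀ a b c d → f a b c d ≤ g a b c d) → ∑₄ f ≤ ∑₄ g
∑₄-mono f≤g = sum-mono (λ a → ∑₃-mono (f≤g a))

∑₃-swap₁₂ : (f : Fin n → Fin n → Fin n → ℚ) → ∑₃ f ≡ ∑₃ (λ a b c → f b a c)
∑₃-swap₁₂ f = ∑-comm (λ a b → sum (f a b))

∑₃-swap₂₃ : (f : Fin n → Fin n → Fin n → ℚ) → ∑₃ f ≡ ∑₃ (λ a b c → f a c b)
∑₃-swap₂₃ f = sum-cong-≗ (λ a → ∑-comm (f a))

∑₄-swap₁₂ : (f : Fin n → Fin n → Fin n → Fin n → ℚ) → ∑₄ f ≡ ∑₄ (λ a b c d → f b a c d)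
∑₄-swap₁₂ f = ∑-comm (λ a b → ∑₂ (f a b))

∑₄-swap₂₃ : (f : Fin n → Fin n → Fin n → Fin n → ℚ) → ∑₄ f ≡ ∑₄ (λ a b c d → f a c b d)
∑₄-swap₂₃ f = sum-cong-≗ (λ a → ∑₃-swap₁₂ (f a))

∑₄-swap₃₄ : (f : Fin n → Fin n → Fin n → Fin n → ℚ) → ∑₄ f ≡ ∑₄ (λ a b c d → f a b d c)
∑₄-swap₃₄ f = sum-cong-≗ (λ a → ∑₃-swap₂₃ (f a))

-- Triples and quadruples of distinct vertices

D₃ : Fin n → Fin n → Fin n → ℚ
D₃ a b c = w a b * (w a c * w b c)

D₄ : Fin n → Fin n → Fin n → Fin n → ℚ
D₄ a b c d = D₃ a b c * (w a d * (w b d * w c d))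

0≤D₃ : ∀ (a b c : Fin n) → 0ℚ ≤ D₃ a b c
0≤D₃ a b c = 0≤* (0≤w a b) (0≤* (0≤w a c) (0≤w b c))

0≤D₄ : ∀ (a b c d : Fin n) → 0ℚ ≤ D₄ a b c d
0≤D₄ a b c d = 0≤* (0≤D₃ a b c) (0≤* (0≤w a d) (0≤* (0≤w b d) (0≤w c d)))

D₃-swap₁₂ : ∀ (a b c : Fin n) → D₃ b a c ≡ D₃ a b c
D₃-swap₁₂ a b c rewrite w-sym b a =
  solve 3 (λ p q r → p :* (r :* q) := p :* (q :* r)) refl (w a b) (w a c) (w b c)

D₃-swap₂₃ : ∀ (a b c : Fin n) → D₃ a c b ≡ D₃ a b c
D₃-swap₂₃ a b c rewrite w-sym c b =
  solve 3 (λ p q r → q :* (p :* r) := p :* (q :* r)) refl (w a b) (w a c) (w b c)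

D₄-swap₁₂ : ∀ (a b c d : Fin n) → D₄ b a c d ≡ D₄ a b c d
D₄-swap₁₂ a b c d = cong₂ _*_ (D₃-swap₁₂ a b c)
  (solve 3 (λ p q r → q :* (p :* r) := p :* (q :* r)) refl (w a d) (w b d) (w c d))

D₄-swap₂₃ : ∀ (a b c d : Fin n) → D₄ a c b d ≡ D₄ a b c d
D₄-swap₂₃ a b c d = cong₂ _*_ (D₃-swap₂₃ a b c)
  (solve 3 (λ p q r → p :* (r :* q) := p :* (q :* r)) refl (w a d) (w b d) (w c d))

D₄-swap₃₄ : ∀ (a b c d : Fin n) → D₄ a b d c ≡ D₄ a b c d
D₄-swap₃₄ a b c d rewrite w-sym d c =
  solve 6 (λ p q r x y z → (p :* (x :* y)) :* (q :* (r :* z)) := (p :* (q :* r)) :* (x :* (y :* z)))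
    refl (w a b) (w a c) (w b c) (w a d) (w b d) (w c d)

-- Inclusion–exclusion: all products δ a d * δ b d etc. are killed by D₃ a b c.
∑D₄ : ∀ (a b c : Fin n) → sum (D₄ a b c) ≡ (ν n - 3ℚ) * D₃ a b c
∑D₄ {n} a b c = trans (sum-cong-≗ pointwise) (trans (sym (*-distribˡ-sum (D₃ a b c) g)) (trans (cong (D₃ a b c *_) ∑g) (ℚ.*-comm (D₃ a b c) _)))
  where
  g : Fin n → ℚ
  g d = 1ℚ - δ a d - δ b d - δ c d
  ∑g : sum g ≡ ν n - 3ℚ
  ∑g = trans (sum-sub (λ d → 1ℚ - δ a d - δ b d) (δ c)) (trans (cong₂ _-_ (trans (sum-sub (λ d → 1ℚ - δ a d) (δ b))
    (cong₂ _-_ (trans (sum-sub (λ _ → 1ℚ) (δ a)) (cong (λ x → ν n - x) (sum-δ a))) (sum-δ b))) (sum-δ c))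
    (solve 1 (λ x → ((x :- con 1ℚ) :- con 1ℚ) :- con 1ℚ := x :- con 3ℚ) refl (ν n)))
  pointwise : ∀ d → D₄ a b c d ≡ D₃ a b c * g d
  pointwise d = trans
    (solve 6 (λ p q r x y z →
       (p :* (q :* r)) :* ((con 1ℚ :- x) :* ((con 1ℚ :- y) :* (con 1ℚ :- z))) :=
       (p :* (q :* r)) :* (con 1ℚ :- x :- y :- z) :+
       ((p :* (x :* y)) :* (q :* r) :+ ((q :* (x :* z)) :* (p :* r) :+ (r :* (y :* z)) :* (p :* q :* (con 1ℚ :- x)))))
       refl (w a b) (w a c) (w b c) (δ a d) (δ b d) (δ c d))
    (trans (cong (D₃ a b c * g d +_)
       (cong₂ _+_ (cong (_* (w a c * w b c)) (w-δδ a b d))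
         (cong₂ _+_ (cong (_* (w a b * w b c)) (w-δδ a c d)) (cong (_* (w a b * w a c * (1ℚ - δ a d))) (w-δδ b c d)))))
    (solve 4 (λ s x y z → s :+ (con 0ℚ :* x :+ (con 0ℚ :* y :+ con 0ℚ :* z)) := s) refl
       (D₃ a b c * g d) (w a c * w b c) (w a b * w b c) (w a b * w a c * (1ℚ - δ a d))))

∑D₃ : ∀ (a b : Fin n) → sum (D₃ a b) ≡ (ν n - 2ℚ) * w a b
∑D₃ {n} a b = trans (sum-cong-≗ pointwise) (trans (sym (*-distribˡ-sum (w a b) g)) (trans (cong (w a b *_) ∑g) (ℚ.*-comm (w a b) _)))
  where
  g : Fin n → ℚ
  g c = 1ℚ - δ a c - δ b c
  ∑g : sum g ≡ ν n - 2ℚ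
  ∑g = trans (sum-sub (λ d → 1ℚ - δ a d) (δ b))
    (trans (cong₂ _-_ (trans (sum-sub (λ _ → 1ℚ) (δ a)) (cong (λ x → ν n - x) (sum-δ a))) (sum-δ b))
    (solve 1 (λ x → (x :- con 1ℚ) :- con 1ℚ := x :- con 2ℚ) refl (ν n)))
  pointwise : ∀ c → D₃ a b c ≡ w a b * g c
  pointwise c = trans
    (solve 3 (λ p x y →
       p :* ((con 1ℚ :- x) :* (con 1ℚ :- y)) := p :* (con 1ℚ :- x :- y) :+ p :* (x :* y))
       refl (w a b) (δ a c) (δ b c))
    (trans (cong (w a b * g c +_) (w-δδ a b c)) (ℚ.+-identityʳ _))

∑₂w : ∑₂ {n} w ≡ ν n * (ν n - 1ℚ)
∑₂w {n} = trans (sum-cong-≗ (λ a → trans (sum-sub (λ _ → 1ℚ) (δ a)) (trans (cong (λ x → ν n - x) (sum-δ a)) (sym (ℚ.*-identityˡ _)))))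
  (sym (*-distribʳ-sum (ν n - 1ℚ) (λ _ → 1ℚ)))

∑₃D₃ : ∑₃ {n} D₃ ≡ (ν n - 2ℚ) * (ν n * (ν n - 1ℚ))
∑₃D₃ {n} = trans (∑₂-cong ∑D₃) (trans (∑₂-* (ν n - 2ℚ) w) (cong ((ν n - 2ℚ) *_) ∑₂w))

-- Pairs of edges of Kₙ and the bound for fractional solutions

0≤x² : ∀ x → 0ℚ ≤ x * x
0≤x² x with ℚ.≤-total 0ℚ x
... | inj₁ 0≤x = 0≤* 0≤x 0≤x
... | inj₂ x≤0 = subst (0ℚ ≤_) (solve 1 (λ y → (:- y) :* (:- y) := y :* y) refl x) (0≤* 0≤-x 0≤-x)
  where 0≤-x = ℚ.neg-antimono-≤ x≤0

*-monoˡ : ∀ {x y z} → 0ℚ ≤ x → y ≤ z → x * y ≤ x * z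
*-monoˡ {x} 0≤x = ℚ.*-monoˡ-≤-nonNeg x {{nonNegative 0≤x}}

-- K a b c d is a quantity attached to the pair of edges ab, cd of Kₙ.
-- ∑⁺ K is twice the sum of K over the pairs of edges sharing an endpoint,
-- and ∑⁻ K eight times its sum over the pairs of disjoint edges.
∑⁺ ∑⁻ : (Fin n → Fin n → Fin n → Fin n → ℚ) → ℚ
∑⁺ K = ∑₃ (λ a b c → D₃ a b c * K a b a c)
∑⁻ K = ∑₄ (λ a b c d → D₄ a b c d * K a b c d)

-- Three distinct vertices leave `n - 3` choices for a fourth.
∑D₄-extend : ∀ (f : Fin n → Fin n → Fin n → ℚ) →
  ∑₄ (λ a b c d → D₄ a b c d * f a b c) ≡ (ν n - 3ℚ) * ∑₃ (λ a b c → D₃ a b c * f a b c)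
∑D₄-extend {n} f = trans (∑₃-cong (λ a b c → trans (sym (*-distribʳ-sum (f a b c) (D₄ a b c)))
    (trans (cong (_* f a b c) (∑D₄ a b c)) (ℚ.*-assoc (ν n - 3ℚ) (D₃ a b c) (f a b c)))))
  (∑₃-* (ν n - 3ℚ) (λ a b c → D₃ a b c * f a b c))

-- `D₄` is symmetric, so vertices may be renamed. This makes the two halves (ab, bc) and (bc, cd) of
-- a path abcd contribute equally.
∑D₄-rotate : ∀ (f : Fin n → Fin n → Fin n → ℚ) →
  ∑₄ (λ a b c d → D₄ a b c d * f b c d) ≡ ∑₄ (λ a b c d → D₄ a b c d * f a b c)
∑D₄-rotate f =
  trans (∑₄-swap₁₂ (λ a b c d → D₄ a b c d * f b c d))
  (trans (∑₄-swap₂₃ (λ a b c d → D₄ b a c d * f a c d))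
  (trans (∑₄-swap₃₄ (λ a b c d → D₄ c a b d * f a b d))
  (∑₄-cong (λ a b c d → cong (_* f a b c)
    (trans (D₄-swap₁₂ a d b c) (trans (D₄-swap₂₃ a b d c) (D₄-swap₃₄ a b c d)))))))

module _ (K : Fin n → Fin n → Fin n → Fin n → ℚ)
         (K-swap : ∀ a b c d → K b a c d ≡ K a b c d)
         (K-sym : ∀ a b c d → K c d a b ≡ K a b c d) where

  -- Here and in `∑⁺-last`, renaming the vertices of a triangle carries any of its three pairs of
  -- sides to the pair ab, ac.
  ∑⁺-middle : ∑₃ (λ a b c → D₃ a b c * K a b b c) ≡ ∑⁺ K
  ∑⁺-middle = trans (∑₃-swap₁₂ (λ a b c → D₃ a b c * K a b b c))
    (∑₃-cong (λ a b c → cong₂ _*_ (D₃-swap₁₂ a b c) (K-swap a b a c)))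

  ∑⁺-last : ∑₃ (λ a b c → D₃ a b c * K a c b c) ≡ ∑⁺ K
  ∑⁺-last = trans (∑₃-swap₂₃ (λ a b c → D₃ a b c * K a c b c))
    (trans (∑₃-cong (λ a b c → cong₂ _*_ (D₃-swap₂₃ a b c)
      (trans (K-sym c b a b) (trans (K-swap b c a b) (K-sym a b b c))))) ∑⁺-middle)

  -- Summing the bad triangle inequalities over the paths of length three of Kₙ.
  fractional-bound : 2ℚ ≤ ν n - 3ℚ → (∀ a b c d → 0ℚ ≤ K a b c d) →
    (∀ a b c d → K a b b c + K b c c d ≤ 1ℚ + K a b c d) →
    2ℚ * ∑⁺ K ≤ ∑₃ {n} D₃ + ½ * ∑⁻ K
  -- The paths give `2 m ∑⁺ K ≤ m ∑₃ D₃ + ∑⁻ K`. The claim multiplied by `m` has `½ m ∑⁻ K` at the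
  -- end, which is no smaller because `m ≥ 2`. The coefficient ½ is the one for which the objective
  -- is at least `1/4 * ∑₃ D₃`.
  fractional-bound 2≤m 0≤K bad = ℚ.*-cancelˡ-≤-pos m {{positive (ℚ.<-≤-trans (ℚ.positive⁻¹ 2ℚ) 2≤m)}} (≤-by _ slack
      (solve 4 (λ μ p s q → μ :* (con 2ℚ :* p) :+ ((μ :* s :+ q :- con 2ℚ :* (μ :* p)) :+ con ½ :* ((μ :- con 2ℚ) :* q))
         := μ :* (s :+ con ½ :* q)) refl m (∑⁺ K) (∑₃ {n} D₃) (∑⁻ K)))
    where
    m = ν n - 3ℚ
    0≤∑⁻ : 0ℚ ≤ ∑⁻ K
    0≤∑⁻ = sum-nonneg λ a → sum-nonneg λ b → sum-nonneg λ c → sum-nonneg λ d → 0≤* (0≤D₄ a b c d) (0≤K a b c d)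
    lhs : ∑₄ (λ a b c d → D₄ a b c d * K a b b c + D₄ a b c d * K b c c d) ≡ 2ℚ * (m * ∑⁺ K)
    lhs = trans (∑₄-+ (λ a b c d → D₄ a b c d * K a b b c) (λ a b c d → D₄ a b c d * K b c c d))
      (trans (cong₂ _+_ extended (trans (∑D₄-rotate (λ a b c → K a b b c)) extended))
        (solve 1 (λ x → x :+ x := con 2ℚ :* x) refl (m * ∑⁺ K)))
      where
      extended = trans (∑D₄-extend (λ a b c → K a b b c)) (cong (m *_) ∑⁺-middle)
    rhs : ∑₄ (λ a b c d → D₄ a b c d * 1ℚ + D₄ a b c d * K a b c d) ≡ m * ∑₃ {n} D₃ + ∑⁻ K
    rhs = trans (∑₄-+ (λ a b c d → D₄ a b c d * 1ℚ) (λ a b c d → D₄ a b c d * K a b c d))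
      (cong (_+ ∑⁻ K) (trans (∑D₄-extend (λ _ _ _ → 1ℚ))
        (cong (m *_) (∑₃-cong (λ a b c → ℚ.*-identityʳ (D₃ a b c))))))
    summed : 2ℚ * (m * ∑⁺ K) ≤ m * ∑₃ {n} D₃ + ∑⁻ K
    summed = subst₂ _≤_ lhs rhs (∑₄-mono (λ a b c d →
      subst₂ _≤_ (ℚ.*-distribˡ-+ (D₄ a b c d) (K a b b c) (K b c c d)) (ℚ.*-distribˡ-+ (D₄ a b c d) 1ℚ (K a b c d))
        (*-monoˡ (0≤D₄ a b c d) (bad a b c d))))
    slack = 0≤+ (0≤- summed) (0≤* {½} (ℚ.nonNegative⁻¹ ½) (0≤* (0≤- 2≤m) 0≤∑⁻))

-- The bound for clusterings

-- A triangle keeps three of its +edges or at most one. If `x` and `y` hold, the right side is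
-- already 3, so transitivity is called on to exclude the two patterns in which `z` and just one of
-- `x`, `y` hold.
two-of-three : ∀ x y z → (x ≡ true → z ≡ true → y ≡ true) → (y ≡ true → z ≡ true → x ≡ true) →
  𝟙 x + 𝟙 y + 𝟙 z ≤ 1ℚ + 2ℚ * (𝟙 x * 𝟙 y)
two-of-three true  true  true  _ _ = toWitness {a? = _ ℚ.≤? _} _
two-of-three true  true  false _ _ = toWitness {a? = _ ℚ.≤? _} _
two-of-three true  false false _ _ = toWitness {a? = _ ℚ.≤? _} _
two-of-three false true  false _ _ = toWitness {a? = _ ℚ.≤? _} _
two-of-three false false true  _ _ = toWitness {a? = _ ℚ.≤? _} _
two-of-three false false false _ _ = toWitness {a? = _ ℚ.≤? _} _
two-of-three true  false true  p _ with () ← p refl refl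
two-of-three false true  true  _ q with () ← q refl refl

𝟙-∧ : ∀ x y → 𝟙 x * 𝟙 y ≡ 𝟙 (x ∧ y)
𝟙-∧ true  y = ℚ.*-identityˡ (𝟙 y)
𝟙-∧ false y = ℚ.*-zeroˡ (𝟙 y)

𝟙-mono : ∀ x y → (x ≡ true → y ≡ true) → 𝟙 x ≤ 𝟙 y
𝟙-mono false y _ = 0≤𝟙 y
𝟙-mono true  y p rewrite p refl = ℚ.≤-refl

𝟙-idem : ∀ x → 𝟙 x * 𝟙 x ≡ 𝟙 x
𝟙-idem true  = refl
𝟙-idem false = refl

w-idem : ∀ (a b : Fin n) → w a b * w a b ≡ w a b
w-idem a b with does (a ≟ b)
... | true  = refl
... | false = refl

module _ (k : Fin n → Fin n → Fin n → Fin n → Bool)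
         (k-swap : ∀ a b c d → k b a c d ≡ k a b c d)
         (k-sym : ∀ a b c d → k c d a b ≡ k a b c d)
         (k-trans : ∀ a b c d e f → k a b c d ≡ true → k c d e f ≡ true → k a b e f ≡ true) where

  private
    K : Fin n → Fin n → Fin n → Fin n → ℚ
    K a b c d = 𝟙 (k a b c d)
    K-swap : ∀ a b c d → K b a c d ≡ K a b c d
    K-swap a b c d = cong 𝟙 (k-swap a b c d)
    K-sym : ∀ a b c d → K c d a b ≡ K a b c d
    K-sym a b c d = cong 𝟙 (k-sym a b c d)

    -- τ a b c indicates that the triangle abc is monochromatic.
    τ : Fin n → Fin n → Fin n → ℚ
    τ a b c = K a b a c * K a b b c

    τ-∧ : ∀ a b c → τ a b c ≡ 𝟙 (k a b a c ∧ k a b b c)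
    τ-∧ a b c = 𝟙-∧ (k a b a c) (k a b b c)

    M : ℚ
    M = ∑₃ (λ a b c → D₃ a b c * τ a b c)

    0≤M : 0ℚ ≤ M
    0≤M = sum-nonneg λ a → sum-nonneg λ b → sum-nonneg λ c → 0≤* (0≤D₃ a b c) (0≤* (0≤𝟙 (k a b a c)) (0≤𝟙 (k a b b c)))

  triangles : 3ℚ * ∑⁺ K ≤ ∑₃ {n} D₃ + 2ℚ * M
  triangles = subst₂ _≤_ lhs rhs (∑₃-mono (λ a b c →
      subst₂ _≤_ (distrib₃ (D₃ a b c) (K a b a c) (K a b b c) (K a c b c)) (distrib₂ (D₃ a b c) (τ a b c))
        (*-monoˡ (0≤D₃ a b c) (two-of-three (k a b a c) (k a b b c) (k a c b c)
          (λ p q → k-trans a b a c b c p q)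
          (λ p q → k-trans a b b c a c p (trans (k-sym a c b c) q))))))
    where
    distrib₃ = solve 4 (λ s x y z → s :* (x :+ y :+ z) := (s :* x :+ s :* y) :+ s :* z) refl
    distrib₂ = solve 2 (λ s x → s :* (con 1ℚ :+ con 2ℚ :* x) := s :+ con 2ℚ :* (s :* x)) refl
    lhs : ∑₃ (λ a b c → (D₃ a b c * K a b a c + D₃ a b c * K a b b c) + D₃ a b c * K a c b c) ≡ 3ℚ * ∑⁺ K
    lhs = trans (∑₃-+ (λ a b c → D₃ a b c * K a b a c + D₃ a b c * K a b b c) (λ a b c → D₃ a b c * K a c b c))
      (trans (cong₂ _+_ (trans (∑₃-+ (λ a b c → D₃ a b c * K a b a c) (λ a b c → D₃ a b c * K a b b c))
               (cong (∑⁺ K +_) (∑⁺-middle K K-swap K-sym))) (∑⁺-last K K-swap K-sym))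
        (solve 1 (λ x → (x :+ x) :+ x := con 3ℚ :* x) refl (∑⁺ K)))
    rhs : ∑₃ (λ a b c → D₃ a b c + 2ℚ * (D₃ a b c * τ a b c)) ≡ ∑₃ {n} D₃ + 2ℚ * M
    rhs = trans (∑₃-+ D₃ (λ a b c → 2ℚ * (D₃ a b c * τ a b c)))
      (cong (∑₃ {n} D₃ +_) (∑₃-* 2ℚ (λ a b c → D₃ a b c * τ a b c)))

  -- If the edge ab lies in t monochromatic triangles abc, then its part contains
  -- t (t - 1) ordered pairs of disjoint edges ac, bd, and t (t - 1) ≥ 3 t - 4.
  private
    y : Fin n → Fin n → Fin n → ℚ
    y a b c = (w a c * w b c) * τ a b c

    y-idem : ∀ a b c → y a b c * y a b c ≡ y a b c
    y-idem a b c = trans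
      (solve 3 (λ p q r → ((p :* q) :* r) :* ((p :* q) :* r) := ((p :* p) :* (q :* q)) :* (r :* r)) refl
        (w a c) (w b c) (τ a b c))
      (cong₂ _*_ (cong₂ _*_ (w-idem a c) (w-idem b c))
        (trans (cong₂ _*_ (τ-∧ a b c) (τ-∧ a b c)) (trans (𝟙-idem (k a b a c ∧ k a b b c)) (sym (τ-∧ a b c)))))

    t : Fin n → Fin n → ℚ
    t a b = sum (y a b)

    -- The square of the count `t` runs over all pairs c, d. Its diagonal is `t` again because `y`
    -- takes only the values 0 and 1.
    t²-t : ∀ a b → ∑₂ (λ c d → w c d * (y a b c * y a b d)) ≡ t a b * t a b - t a b
    t²-t a b = trans (sum-cong-≗ (λ c → trans (sum-cong-≗ (λ d →
          solve 2 (λ p q → (con 1ℚ :- p) :* q := q :- p :* q) refl (δ c d) (y a b c * y a b d)))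
        (trans (sum-sub (λ d → y a b c * y a b d) (λ d → δ c d * (y a b c * y a b d)))
          (cong₂ _-_ (sym (*-distribˡ-sum (y a b c) (y a b)))
            (trans (δ-sum c (λ d → y a b c * y a b d)) (y-idem a b c))))))
      (trans (sum-sub (λ c → y a b c * t a b) (y a b)) (cong (_- t a b) (sym (*-distribʳ-sum (t a b) (y a b)))))

    -- The two triangles share ab: the first puts ac into the part of ab, the second puts bd there.
    ττ≤K : ∀ a b c d → τ a b c * τ a b d ≤ K a c b d
    ττ≤K a b c d = subst (_≤ K a c b d)
      (trans (sym (𝟙-∧ (k a b a c ∧ k a b b c) (k a b a d ∧ k a b b d))) (cong₂ _*_ (sym (τ-∧ a b c)) (sym (τ-∧ a b d))))
      (𝟙-mono _ _ (λ p → implied (k a b a c) (k a b b c) (k a b a d) (k a b b d) p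
        (λ q r → k-trans a c a b b d (trans (k-sym a b a c) q) r)))
      where
      implied : ∀ x₁ x₂ x₃ x₄ → (x₁ ∧ x₂) ∧ (x₃ ∧ x₄) ≡ true →
                (x₁ ≡ true → x₄ ≡ true → k a c b d ≡ true) → k a c b d ≡ true
      implied true true true true _ f = f refl refl

    per-edge : ∀ a b → 3ℚ * (w a b * t a b) - 4ℚ * w a b ≤ ∑₂ (λ c d → D₄ a b c d * K a c b d)
    -- The line `3 t - 4` is the tangent of `t (t - 1)` at `t = 2`, and the remainder is `(t - 2)²`.
    per-edge a b = ℚ.≤-trans (≤-by _ (0≤* (0≤w a b) (0≤x² (t a b - 2ℚ)))
        (solve 2 (λ p x → (con 3ℚ :* (p :* x) :- con 4ℚ :* p) :+ p :* ((x :- con 2ℚ) :* (x :- con 2ℚ)) := p :* (x :* x :- x))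
          refl (w a b) (t a b)))
      (subst (_≤ ∑₂ (λ c d → D₄ a b c d * K a c b d))
        (trans (∑₂-* (w a b) (λ c d → w c d * (y a b c * y a b d))) (cong (w a b *_) (t²-t a b)))
        (∑₂-mono (λ c d → subst (_≤ D₄ a b c d * K a c b d)
          (solve 8 (λ p q r u v x s s′ → (p :* (q :* r)) :* (u :* (v :* x)) :* (s :* s′) :=
               p :* (x :* (((q :* r) :* s) :* ((u :* v) :* s′)))) refl
             (w a b) (w a c) (w b c) (w a d) (w b d) (w c d) (τ a b c) (τ a b d))
          (*-monoˡ (0≤D₄ a b c d) (ττ≤K a b c d)))))

  disjoint-pairs : 3ℚ * M - 4ℚ * ∑₂ {n} w ≤ ∑⁻ K
  disjoint-pairs = subst₂ _≤_ lhs rhs (∑₂-mono per-edge)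
    where
    lhs : ∑₂ (λ a b → 3ℚ * (w a b * t a b) - 4ℚ * w a b) ≡ 3ℚ * M - 4ℚ * ∑₂ {n} w
    lhs = trans (sum-cong-≗ (λ a → sum-sub (λ b → 3ℚ * (w a b * t a b)) (λ b → 4ℚ * w a b)))
      (trans (sum-sub (λ a → sum (λ b → 3ℚ * (w a b * t a b))) (λ a → sum (λ b → 4ℚ * w a b)))
        (cong₂ _-_ (trans (∑₂-* 3ℚ (λ a b → w a b * t a b)) (cong (3ℚ *_) (∑₂-cong (λ a b →
            trans (*-distribˡ-sum (w a b) (y a b)) (sum-cong-≗ (λ c → sym (ℚ.*-assoc (w a b) (w a c * w b c) (τ a b c))))))))
          (∑₂-* 4ℚ w)))
    -- The pairs found are ac, bd; exchanging the names b and c turns them into ab, cd.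
    rhs : ∑₂ (λ a b → ∑₂ (λ c d → D₄ a b c d * K a c b d)) ≡ ∑⁻ K
    rhs = trans (∑₄-swap₂₃ (λ a b c d → D₄ a b c d * K a c b d))
      (∑₄-cong (λ a b c d → cong (_* K a b c d) (D₄-swap₂₃ a b c d)))

  -- To bound `½ * ∑⁺ K`, `triangles` is taken 1/6 times, which leaves a debt of `1/3 * M`. The
  -- coefficient 1/8 of `∑⁻ K` in the objective fixes the multiple of `disjoint-pairs`; it repays
  -- `3/8 * M` at the price of `½ * ∑₂ w`. The surplus is `1/24 * M`, so the slope 3 of the tangent
  -- has room: any slope from 8/3 on covers the debt.
  integral-bound : ℤ.+ 1 / 3 * ∑₃ {n} D₃ - ½ * ∑₂ {n} w ≤ ½ * (∑₃ {n} D₃ - ∑⁺ K) + ℤ.+ 1 / 8 * ∑⁻ K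
  integral-bound = ≤-by _
    (0≤+ (0≤* {ℤ.+ 1 / 6} (ℚ.nonNegative⁻¹ _) (0≤- triangles))
      (0≤+ (0≤* {ℤ.+ 1 / 8} (ℚ.nonNegative⁻¹ _) (0≤- disjoint-pairs))
        (0≤* {ℤ.+ 1 / 24} (ℚ.nonNegative⁻¹ _) 0≤M)))
    (solve 5 (λ s u p q m →
        (con (ℤ.+ 1 / 3) :* s :- con ½ :* u) :+ (con (ℤ.+ 1 / 6) :* (s :+ con 2ℚ :* m :- con 3ℚ :* p) :+
          (con (ℤ.+ 1 / 8) :* (q :- (con 3ℚ :* m :- con 4ℚ :* u)) :+ con (ℤ.+ 1 / 24) :* m)) :=
        con ½ :* (s :- p) :+ con (ℤ.+ 1 / 8) :* q) refl (∑₃ {n} D₃) (∑₂ {n} w) (∑⁺ K) (∑⁻ K) M)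

-- From sums over lists to sums over `Fin n`

sumOver-cong : {A : Set} (xs : List A) {f g : A → ℚ} → (∀ x → f x ≡ g x) → sumOver xs f ≡ sumOver xs g
sumOver-cong []       f≡g = refl
sumOver-cong (x ∷ xs) f≡g = cong₂ _+_ (f≡g x) (sumOver-cong xs f≡g)

sumOver-++ : {A : Set} (xs ys : List A) (f : A → ℚ) → sumOver (xs ++ ys) f ≡ sumOver xs f + sumOver ys f
sumOver-++ []       ys f = sym (ℚ.+-identityˡ _)
sumOver-++ (x ∷ xs) ys f = trans (cong (f x +_) (sumOver-++ xs ys f)) (sym (ℚ.+-assoc (f x) _ _))

sumOver-map : {A B : Set} (g : A → B) (xs : List A) (f : B → ℚ) → sumOver (map g xs) f ≡ sumOver xs (λ x → f (g x))
sumOver-map g []       f = refl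
sumOver-map g (x ∷ xs) f = cong (f (g x) +_) (sumOver-map g xs f)

sumOver-filter : {A : Set} {P : A → Set} (P? : Decidable P) (xs : List A) (f : A → ℚ) →
  sumOver (filter P? xs) f ≡ sumOver xs (λ x → 𝟙 (does (P? x)) * f x)
sumOver-filter P? []       f = refl
sumOver-filter P? (x ∷ xs) f with does (P? x)
... | true  = cong₂ _+_ (sym (ℚ.*-identityˡ (f x))) (sumOver-filter P? xs f)
... | false = trans (sumOver-filter P? xs f)
  (trans (sym (ℚ.+-identityˡ _)) (cong (_+ _) (sym (ℚ.*-zeroˡ (f x)))))

sumOver-mapMaybe : {A B : Set} (g : A → Maybe B) (xs : List A) (f : B → ℚ) →
  sumOver (mapMaybe g xs) f ≡ sumOver xs (λ x → maybe′ f 0ℚ (g x))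
sumOver-mapMaybe g []       f = refl
sumOver-mapMaybe g (x ∷ xs) f with g x
... | just y  = cong (f y +_) (sumOver-mapMaybe g xs f)
... | nothing = trans (sumOver-mapMaybe g xs f) (sym (ℚ.+-identityˡ _))

sumOver-cartesianProduct : {A B : Set} (xs : List A) (ys : List B) (f : A × B → ℚ) →
  sumOver (cartesianProduct xs ys) f ≡ sumOver xs (λ x → sumOver ys (λ y → f (x , y)))
sumOver-cartesianProduct []       ys f = refl
sumOver-cartesianProduct (x ∷ xs) ys f = trans (sumOver-++ (map (x ,_) ys) _ f)
  (cong₂ _+_ (sumOver-map (x ,_) ys f) (sumOver-cartesianProduct xs ys f))

sumOver-edges : (f : Edge n → ℚ) (F : Fin n → Fin n → ℚ) → (∀ e → f e ≡ F (src e) (tgt e)) →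
  sumOver (edges n) f ≡ ∑₂ (λ u v → 𝟙 (does (u <? v)) * F u v)
sumOver-edges {n} f F f≡F = trans (sumOver-mapMaybe _ (cartesianProduct (allFin n) (allFin n)) f)
  (trans (sumOver-cartesianProduct (allFin n) (allFin n) _)
  (trans (sumOver-tabulate id _)
  (trans (sum-cong-≗ (λ u → sumOver-tabulate id _))
  (∑₂-cong (λ u v → pointwise (u <? v))))))
  where
  pointwise : ∀ {u v} (u<?v : Dec (u Fin.< v)) →
    maybe′ f 0ℚ (Maybe.map (λ u<v → edge u v u<v) (dec⇒maybe u<?v)) ≡ 𝟙 (does u<?v) * F u v
  pointwise {u} {v} (yes u<v) = trans (f≡F (edge u v u<v)) (sym (ℚ.*-identityˡ (F u v)))
  pointwise {u} {v} (no _)    = sym (ℚ.*-zeroˡ (F u v))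

𝟙<+𝟙> : ∀ (u v : Fin n) → 𝟙 (does (u <? v)) + 𝟙 (does (v <? u)) ≡ w u v
𝟙<+𝟙> u v with <-cmp u v
... | tri< u<v u≢v v≮u rewrite dec-true (u <? v) u<v | dec-false (v <? u) v≮u | dec-false (u ≟ v) u≢v = refl
... | tri≈ u≮v u≡v v≮u rewrite dec-false (u <? v) u≮v | dec-false (v <? u) v≮u | dec-true (u ≟ v) u≡v = refl
... | tri> u≮v u≢v v<u rewrite dec-false (u <? v) u≮v | dec-true (v <? u) v<u | dec-false (u ≟ v) u≢v = refl

-- Adding the sum with `u` and `v` exchanged replaces the condition `u < v` by `u ≢ v`, that is, by
-- the factor `w u v`. Hence the 2.
sumOver-filter-edges : {P : Edge n → Set} (P? : Decidable P) (p : Fin n → Fin n → Bool) (f : Edge n → ℚ) (F : Fin n → Fin n → ℚ) →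
  (∀ e → does (P? e) ≡ p (src e) (tgt e)) → (∀ e → f e ≡ F (src e) (tgt e)) →
  (∀ u v → p u v ≡ p v u) → (∀ u v → F u v ≡ F v u) →
  2ℚ * sumOver (filter P? (edges n)) f ≡ ∑₂ (λ u v → w u v * (𝟙 (p u v) * F u v))
sumOver-filter-edges {n} P? p f F P≡p f≡F p-sym F-sym = begin
  2ℚ * sumOver (filter P? (edges n)) f      ≡⟨ cong (2ℚ *_) (trans (sumOver-filter P? (edges n) f)
                                                 (sumOver-edges _ (λ u v → 𝟙 (p u v) * F u v) (λ e → cong₂ (λ b x → 𝟙 b * x) (P≡p e) (f≡F e)))) ⟩
  2ℚ * ∑₂ below                             ≡⟨ solve 1 (λ x → con 2ℚ :* x := x :+ x) refl (∑₂ below) ⟩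
  ∑₂ below + ∑₂ below                       ≡⟨ cong (∑₂ below +_) (∑-comm below) ⟩
  ∑₂ below + ∑₂ (λ u v → below v u)         ≡⟨ ∑₂-+ below (λ u v → below v u) ⟨
  ∑₂ (λ u v → below u v + below v u)        ≡⟨ ∑₂-cong (λ u v → trans (cong (below u v +_) (cong₂ (λ b x → 𝟙 (does (v <? u)) * (𝟙 b * x)) (p-sym v u) (F-sym v u)))
                                                 (trans (sym (ℚ.*-distribʳ-+ (𝟙 (p u v) * F u v) (𝟙 (does (u <? v))) _)) (cong (_* (𝟙 (p u v) * F u v)) (𝟙<+𝟙> u v)))) ⟩
  ∑₂ (λ u v → w u v * (𝟙 (p u v) * F u v))  ∎
  where
  open ≡-Reasoning
  below : Fin n → Fin n → ℚ
  below u v = 𝟙 (does (u <? v)) * (𝟙 (p u v) * F u v)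

-- The edges of Kₙ as vertices of the instance

-- The edges of Kₙ₊₁ are the n edges at vertex 0, followed by the edges of Kₙ.
T : ℕ → ℕ
T zero    = zero
T (suc n) = n ℕ.+ T n

ends : ∀ n → Fin (T n) → Fin n × Fin n
ends (suc n) u = [ (λ b → zero , suc b) , (λ u′ → Product.map suc suc (ends n u′)) ]′ (splitAt n u)

-- The value of f at the edge ab, and the junk value e when a = b.
at : {A : Set} → Fin n → Fin n → A → (Fin (T n) → A) → A
at         zero    zero    e f = e
at {suc n} zero    (suc b) e f = f (b ↑ˡ T n)
at {suc n} (suc a) zero    e f = f (a ↑ˡ T n)
at {suc n} (suc a) (suc b) e f = at a b e (λ u → f (n ↑ʳ u))

at-sym : {A : Set} (a b : Fin n) (e : A) (f : Fin (T n) → A) → at a b e f ≡ at b a e f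
at-sym zero    zero    e f = refl
at-sym zero    (suc b) e f = refl
at-sym (suc a) zero    e f = refl
at-sym {suc n} (suc a) (suc b) e f = at-sym a b e (λ u → f (n ↑ʳ u))

at-map : {A B : Set} {a b : Fin n} → a ≢ b → {e : A} {e′ : B} {f : Fin (T n) → A} {g : Fin (T n) → B} (h : A → B) →
  (∀ u → h (f u) ≡ g u) → h (at a b e f) ≡ at a b e′ g
at-map {a = zero}  {zero}  a≢b h hf≡g = contradiction refl a≢b
at-map {suc n} {a = zero}  {suc b} a≢b h hf≡g = hf≡g (b ↑ˡ T n)
at-map {suc n} {a = suc a} {zero}  a≢b h hf≡g = hf≡g (a ↑ˡ T n)
at-map {suc n} {a = suc a} {suc b} a≢b h hf≡g = at-map (λ a≡b → a≢b (cong suc a≡b)) h (λ u → hf≡g (n ↑ʳ u))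

-- `ends` lists the smaller endpoint first, whichever of `a` and `b` that is.
at-ends : ∀ {a b : Fin n} e → a ≢ b → at a b e (ends n) ≡ (a , b) ⊎ at a b e (ends n) ≡ (b , a)
at-ends {_}     {zero}  {zero}  e a≢b = contradiction refl a≢b
at-ends {suc n} {zero}  {suc b} e a≢b rewrite splitAt-↑ˡ n b (T n) = inj₁ refl
at-ends {suc n} {suc a} {zero}  e a≢b rewrite splitAt-↑ˡ n a (T n) = inj₂ refl
at-ends {suc n} {suc a} {suc b} e a≢b = Sum.map (trans lift ∘ cong s) (trans lift ∘ cong s) (at-ends (a , b) a≢b′)
  where
  s = Product.map suc suc
  a≢b′ = λ a≡b → a≢b (cong suc a≡b)
  lift : at a b e (λ u → ends (suc n) (n ↑ʳ u)) ≡ s (at a b (a , b) (ends n))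
  lift = sym (at-map a≢b′ s (λ u → sym (cong [ _ , _ ]′ (splitAt-↑ʳ n (T n) u))))

-- Each edge is reached from its two orientations, and `w` removes the junk on the diagonal.
∑-at : ∀ n e (f : Fin (T n) → ℚ) → ∑₂ {n} (λ a b → w a b * at a b e f) ≡ 2ℚ * sum f
∑-at zero    e f = trans (sum-zero {zero} (λ ())) (cong (2ℚ *_) (sym (sum-zero {zero} {f} (λ ()))))
∑-at (suc n) e f = begin
  ∑₂ g                                                        ≡⟨ sum-suc (λ a → sum (g a)) ⟩
  sum (g zero) + sum (λ a → sum (g (suc a)))                  ≡⟨ cong₂ _+_ first (trans (sum-cong-≗ rest) (∑-distrib-+ new (λ a → sum (λ b → w a b * at a b e old)))) ⟩
  sum new + (sum new + ∑₂ {n} (λ a b → w a b * at a b e old))     ≡⟨ cong (λ x → sum new + (sum new + x)) (∑-at n e old) ⟩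
  sum new + (sum new + 2ℚ * sum old)                          ≡⟨ solve 2 (λ x y → x :+ (x :+ con 2ℚ :* y) := con 2ℚ :* (x :+ y)) refl (sum new) (sum old) ⟩
  2ℚ * (sum new + sum old)                                    ≡⟨ cong (2ℚ *_) (sum-++ n f) ⟨
  2ℚ * sum f                                                  ∎
  where
  open ≡-Reasoning
  g : Fin (suc n) → Fin (suc n) → ℚ
  g a b = w a b * at a b e f
  new : Fin n → ℚ
  new b = f (b ↑ˡ T n)
  old : Fin (T n) → ℚ
  old u = f (n ↑ʳ u)
  first : sum (g zero) ≡ sum new
  first = trans (sum-suc (g zero)) (trans (cong₂ _+_ (ℚ.*-zeroˡ e) (sum-cong-≗ (λ b → ℚ.*-identityˡ (new b)))) (ℚ.+-identityˡ _))
  rest : ∀ a → sum (g (suc a)) ≡ new a + sum (λ b → w a b * at a b e old)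
  rest a = trans (sum-suc (g (suc a))) (cong (_+ sum (λ b → w a b * at a b e old)) (ℚ.*-identityˡ (new a)))

-- Nested, this supplies all the distinctness hypotheses under a product of `w`s, so that a summand
-- needs to be evaluated only at distinct vertices.
w-guard : ∀ (a b : Fin n) {x y} → (a ≢ b → x ≡ y) → w a b * x ≡ w a b * y
w-guard a b {x} {y} x≡y with a ≟ b
... | yes _  = trans (ℚ.*-zeroˡ x) (sym (ℚ.*-zeroˡ y))
... | no a≢b = cong (1ℚ *_) (x≡y a≢b)

_∈ₑ_ : Fin n → Fin n × Fin n → Set
a ∈ₑ (c , d) = a ≡ c ⊎ a ≡ d

_∈ₑ?_ : (a : Fin n) (q : Fin n × Fin n) → Dec (a ∈ₑ q)
a ∈ₑ? (c , d) = (a ≟ c) ⊎-dec (a ≟ d)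

Meets : Fin n × Fin n → Fin n × Fin n → Set
Meets (a , b) q = a ∈ₑ q ⊎ b ∈ₑ q

meets? : (p q : Fin n × Fin n) → Dec (Meets p q)
meets? (a , b) q = (a ∈ₑ? q) ⊎-dec (b ∈ₑ? q)

Meets-sym : ∀ (p q : Fin n × Fin n) → Meets p q → Meets q p
Meets-sym p q (inj₁ (inj₁ eq)) = inj₁ (inj₁ (sym eq))
Meets-sym p q (inj₁ (inj₂ eq)) = inj₂ (inj₁ (sym eq))
Meets-sym p q (inj₂ (inj₁ eq)) = inj₁ (inj₂ (sym eq))
Meets-sym p q (inj₂ (inj₂ eq)) = inj₂ (inj₂ (sym eq))

-- Every edge of Kₙ also meets itself. This diagonal gives no +edge, since an `Edge` has distinct
-- ends.
adj : ∀ n → Fin (T n) → Fin (T n) → Bool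
adj n u v = does (meets? (ends n u) (ends n v))

adj-sym : ∀ n (u v : Fin (T n)) → adj n u v ≡ adj n v u
adj-sym n u v = does-⇔ (mk⇔ (Meets-sym (ends n u) (ends n v)) (Meets-sym (ends n v) (ends n u))) (meets? (ends n u) (ends n v)) (meets? (ends n v) (ends n u))

lineGraph : ℕ → Instance
lineGraph n = record
  { vertices = T n
  ; sign     = λ e → if adj n (src e) (tgt e) then Sign.+ else Sign.-
  }

-- The objective as a sum over vertices of Kₙ

-- The possible truth values of a = c, a = d, b = c and b = d for edges ab and cd.
data Pattern : Bool → Bool → Bool → Bool → Set where
  none    : Pattern false false false false
  a=c-    : Pattern true  false false false
  a=d-    : Pattern false true  false false
  b=c-    : Pattern false false true  false
  b=d-    : Pattern false false false true
  equal   : Pattern true  false false true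
  flipped : Pattern false true  true  false

pattern! : ∀ {a b c d : Fin n} → a ≢ b → c ≢ d →
  Pattern (does (a ≟ c)) (does (a ≟ d)) (does (b ≟ c)) (does (b ≟ d))
pattern! {a = a} {b} {c} {d} a≢b c≢d with a ≟ c | a ≟ d | b ≟ c | b ≟ d
... | yes refl | yes refl | _        | _        = contradiction refl c≢d
... | yes refl | no _     | yes refl | _        = contradiction refl a≢b
... | yes refl | no _     | no _     | yes _ = equal
... | yes refl | no _     | no _     | no _  = a=c-
... | no _     | yes refl | _        | yes refl = contradiction refl a≢b
... | no _     | yes refl | yes _    | no _ = flipped
... | no _     | yes refl | no _     | no _ = a=d-
... | no _     | no _     | yes refl | yes refl = contradiction refl c≢d
... | no _     | no _     | yes _    | no _ = b=c-
... | no _     | no _     | no _     | yes _ = b=d-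
... | no _     | no _     | no _     | no _ = none

-- With x, y, z, t for a = c, a = d, b = c, b = d, the first disjunction says that the edges ab and
-- cd coincide, and the negated one that they meet.
disjoint-weight : ∀ {x y z t} → Pattern x y z t →
  (1ℚ - 𝟙 ((x ∧ t) ∨ (y ∧ z))) * 𝟙 (not ((x ∨ y) ∨ (z ∨ t))) ≡
  (1ℚ - 𝟙 x) * ((1ℚ - 𝟙 y) * ((1ℚ - 𝟙 z) * (1ℚ - 𝟙 t)))
disjoint-weight none    = refl
disjoint-weight a=c-    = refl
disjoint-weight a=d-    = refl
disjoint-weight b=c-    = refl
disjoint-weight b=d-    = refl
disjoint-weight equal   = refl
disjoint-weight flipped = refl

-- One summand for each way of sharing exactly one endpoint; `𝟙 x * (1ℚ - 𝟙 t)` stands for a = c and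
-- b ≠ d. `Pattern` excludes truth values such as x = y = true, for which the two sides can differ.
meeting-weight : ∀ {x y z t} → Pattern x y z t →
  (1ℚ - 𝟙 ((x ∧ t) ∨ (y ∧ z))) * 𝟙 ((x ∨ y) ∨ (z ∨ t)) ≡
  (𝟙 x * (1ℚ - 𝟙 t) + 𝟙 y * (1ℚ - 𝟙 z)) + (𝟙 z * (1ℚ - 𝟙 y) + 𝟙 t * (1ℚ - 𝟙 x))
meeting-weight none    = refl
meeting-weight a=c-    = refl
meeting-weight a=d-    = refl
meeting-weight b=c-    = refl
meeting-weight b=d-    = refl
meeting-weight equal   = refl
meeting-weight flipped = refl

module _ (e₀ : Fin (T n)) where

  -- The junk value `e₀` at `a = b` is harmless in the sums, where the factor `w a b` vanishes.
  edgeAt : Fin n → Fin n → Fin (T n)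
  edgeAt a b = at a b e₀ id

  edgeAt-sym : ∀ a b → edgeAt a b ≡ edgeAt b a
  edgeAt-sym a b = at-sym a b e₀ id

  ends-edgeAt : ∀ {a b} → a ≢ b → ends n (edgeAt a b) ≡ (a , b) ⊎ ends n (edgeAt a b) ≡ (b , a)
  ends-edgeAt {a} {b} a≢b = Sum.map (trans eq) (trans eq) (at-ends (a , b) a≢b)
    where eq = at-map a≢b (ends n) (λ _ → refl)

  ∑-edgeAt : ∀ (f : Fin (T n) → ℚ) → ∑₂ (λ a b → w a b * f (edgeAt a b)) ≡ 2ℚ * sum f
  ∑-edgeAt f = trans (∑₂-cong (λ a b → w-guard a b (λ a≢b → at-map a≢b f (λ _ → refl)))) (∑-at n 0ℚ f)

  ∑₂-edgeAt : ∀ (f : Fin (T n) → Fin (T n) → ℚ) →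
    ∑₄ (λ a b c d → w a b * (w c d * f (edgeAt a b) (edgeAt c d))) ≡ 4ℚ * ∑₂ f
  ∑₂-edgeAt f = begin
    ∑₄ (λ a b c d → w a b * (w c d * f (edgeAt a b) (edgeAt c d)))  ≡⟨ ∑₂-cong (λ a b → trans (∑₂-* (w a b) (λ c d → w c d * f (edgeAt a b) (edgeAt c d))) (cong (w a b *_) (∑-edgeAt (f (edgeAt a b))))) ⟩
    ∑₂ (λ a b → w a b * (2ℚ * sum (f (edgeAt a b))))                ≡⟨ ∑-edgeAt (λ u → 2ℚ * sum (f u)) ⟩
    2ℚ * sum (λ u → 2ℚ * sum (f u))                                 ≡⟨ cong (2ℚ *_) (*-distribˡ-sum 2ℚ (λ u → sum (f u))) ⟨
    2ℚ * (2ℚ * ∑₂ f)                                                ≡⟨ solve 1 (λ x → con 2ℚ :* (con 2ℚ :* x) := con 4ℚ :* x) refl (∑₂ f) ⟩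
    4ℚ * ∑₂ f                                                       ∎
    where open ≡-Reasoning

  edgeAt-≟ : ∀ {a b c d} → a ≢ b → c ≢ d →
    does (edgeAt a b ≟ edgeAt c d) ≡ (does (a ≟ c) ∧ does (b ≟ d)) ∨ (does (a ≟ d) ∧ does (b ≟ c))
  edgeAt-≟ {a} {b} {c} {d} a≢b c≢d =
    does-⇔ (mk⇔ to from) (edgeAt a b ≟ edgeAt c d) (((a ≟ c) ×-dec (b ≟ d)) ⊎-dec ((a ≟ d) ×-dec (b ≟ c)))
    where
    to : edgeAt a b ≡ edgeAt c d → (a ≡ c × b ≡ d) ⊎ (a ≡ d × b ≡ c)
    to eq with ends-edgeAt a≢b | ends-edgeAt c≢d | cong (ends n) eq
    ... | inj₁ p | inj₁ q | r with refl ← trans (sym p) (trans r q) = inj₁ (refl , refl)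
    ... | inj₁ p | inj₂ q | r with refl ← trans (sym p) (trans r q) = inj₂ (refl , refl)
    ... | inj₂ p | inj₁ q | r with refl ← trans (sym p) (trans r q) = inj₂ (refl , refl)
    ... | inj₂ p | inj₂ q | r with refl ← trans (sym p) (trans r q) = inj₁ (refl , refl)
    from : (a ≡ c × b ≡ d) ⊎ (a ≡ d × b ≡ c) → edgeAt a b ≡ edgeAt c d
    from (inj₁ (refl , refl)) = refl
    from (inj₂ (refl , refl)) = edgeAt-sym a b

  ∈ₑ-ends : ∀ x {c d} → c ≢ d → does (x ∈ₑ? ends n (edgeAt c d)) ≡ does (x ≟ c) ∨ does (x ≟ d)
  ∈ₑ-ends x {c} {d} c≢d with ends n (edgeAt c d) | ends-edgeAt c≢d
  ... | _ | inj₁ refl = refl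
  ... | _ | inj₂ refl = does-⇔ (mk⇔ Sum.swap Sum.swap) (x ∈ₑ? (d , c)) (x ∈ₑ? (c , d))

  adj-edgeAt : ∀ {a b c d} → a ≢ b → c ≢ d →
    adj n (edgeAt a b) (edgeAt c d) ≡ (does (a ≟ c) ∨ does (a ≟ d)) ∨ (does (b ≟ c) ∨ does (b ≟ d))
  adj-edgeAt {a} {b} {c} {d} a≢b c≢d = trans oriented (cong₂ _∨_ (∈ₑ-ends a c≢d) (∈ₑ-ends b c≢d))
    where
    q = ends n (edgeAt c d)
    oriented : adj n (edgeAt a b) (edgeAt c d) ≡ does (meets? (a , b) q)
    oriented with ends n (edgeAt a b) | ends-edgeAt a≢b
    ... | _ | inj₁ refl = refl
    ... | _ | inj₂ refl = does-⇔ (mk⇔ Sum.swap Sum.swap) (meets? (b , a) q) (meets? (a , b) q)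

  module _ (F : Fin (T n) → Fin (T n) → ℚ) (F-sym : ∀ u v → F u v ≡ F v u) where

    private
      K : Fin n → Fin n → Fin n → Fin n → ℚ
      K a b c d = F (edgeAt a b) (edgeAt c d)

    sumOver-E⁻ : (f : Edge (T n) → ℚ) → (∀ e → f e ≡ F (src e) (tgt e)) →
      (ℤ.+ 8 / 1) * sumOver (E⁻ (lineGraph n)) f ≡ ∑⁻ K
    sumOver-E⁻ f f≡F = begin
      (ℤ.+ 8 / 1) * sumOver (E⁻ (lineGraph n)) f           ≡⟨ solve 1 (λ x → con (ℤ.+ 8 / 1) :* x := con 4ℚ :* (con 2ℚ :* x)) refl (sumOver (E⁻ (lineGraph n)) f) ⟩
      4ℚ * (2ℚ * sumOver (E⁻ (lineGraph n)) f)             ≡⟨ cong (4ℚ *_) (sumOver-filter-edges _ (λ u v → not (adj n u v)) f F does-sign f≡F (λ u v → cong not (adj-sym n u v)) F-sym) ⟩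
      4ℚ * ∑₂ g                                            ≡⟨ ∑₂-edgeAt g ⟨
      ∑₄ (λ a b c d → w a b * (w c d * g (edgeAt a b) (edgeAt c d)))  ≡⟨ ∑₄-cong pointwise ⟩
      ∑⁻ K                                                 ∎
      where
      open ≡-Reasoning
      g : Fin (T n) → Fin (T n) → ℚ
      g u v = w u v * (𝟙 (not (adj n u v)) * F u v)
      does-sign : ∀ e → does (sign (lineGraph n) e Sign.≟ Sign.-) ≡ not (adj n (src e) (tgt e))
      does-sign e with adj n (src e) (tgt e)
      ... | true  = refl
      ... | false = refl
      pointwise : ∀ a b c d → w a b * (w c d * g (edgeAt a b) (edgeAt c d)) ≡ D₄ a b c d * K a b c d
      pointwise a b c d = trans (w-guard a b (λ a≢b → w-guard c d (λ c≢d → trans (sym (ℚ.*-assoc (w (edgeAt a b) (edgeAt c d)) (𝟙 (not (adj n (edgeAt a b) (edgeAt c d)))) (K a b c d)))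
          (cong (_* K a b c d) (trans (cong₂ (λ x y → (1ℚ - 𝟙 x) * 𝟙 (not y)) (edgeAt-≟ a≢b c≢d) (adj-edgeAt a≢b c≢d))
            (disjoint-weight (pattern! a≢b c≢d)))))))
        (solve 7 (λ p q r x y z k → p :* (z :* ((q :* (x :* (r :* y))) :* k)) := ((p :* (q :* r)) :* (x :* (y :* z))) :* k) refl
          (w a b) (w a c) (w b c) (w a d) (w b d) (w c d) (K a b c d))

    -- A pair of edges has eight descriptions: two orders, and two orientations of each edge. `S`
    -- collects those with a = c; reversing ab, cd or both reduces the other three ways of meeting
    -- to it. The factor `δ a c` then eliminates c, which leaves `∑⁺ K` four times.
    sumOver-E⁺ : (f : Edge (T n) → ℚ) → (∀ e → f e ≡ F (src e) (tgt e)) →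
      (ℤ.+ 8 / 1) * sumOver (E⁺ (lineGraph n)) f ≡ 4ℚ * ∑⁺ K
    sumOver-E⁺ f f≡F = begin
      (ℤ.+ 8 / 1) * sumOver (E⁺ (lineGraph n)) f           ≡⟨ solve 1 (λ x → con (ℤ.+ 8 / 1) :* x := con 4ℚ :* (con 2ℚ :* x)) refl (sumOver (E⁺ (lineGraph n)) f) ⟩
      4ℚ * (2ℚ * sumOver (E⁺ (lineGraph n)) f)             ≡⟨ cong (4ℚ *_) (sumOver-filter-edges _ (adj n) f F does-sign f≡F (adj-sym n) F-sym) ⟩
      4ℚ * ∑₂ g                                            ≡⟨ ∑₂-edgeAt g ⟨
      ∑₄ (λ a b c d → w a b * (w c d * g (edgeAt a b) (edgeAt c d)))  ≡⟨ ∑₄-cong pointwise ⟩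
      ∑₄ (λ a b c d → (S a b c d + S a b d c) + (S b a c d + S b a d c)) ≡⟨ trans (∑₄-+ _ _) (cong₂ _+_ (∑₄-+ _ _) (∑₄-+ _ _)) ⟩
      (∑₄ S + ∑₄ (λ a b c d → S a b d c)) + (∑₄ (λ a b c d → S b a c d) + ∑₄ (λ a b c d → S b a d c))
        ≡⟨ cong₂ _+_ (cong (∑₄ S +_) (sym (∑₄-swap₃₄ S)))
             (cong₂ _+_ (sym (∑₄-swap₁₂ S)) (trans (sym (∑₄-swap₁₂ (λ a b c d → S a b d c))) (sym (∑₄-swap₃₄ S)))) ⟩
      (∑₄ S + ∑₄ S) + (∑₄ S + ∑₄ S)                        ≡⟨ solve 1 (λ x → (x :+ x) :+ (x :+ x) := con 4ℚ :* x) refl (∑₄ S) ⟩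
      4ℚ * ∑₄ S                                            ≡⟨ cong (4ℚ *_) collapse ⟩
      4ℚ * ∑⁺ K                                            ∎
      where
      open ≡-Reasoning
      g : Fin (T n) → Fin (T n) → ℚ
      g u v = w u v * (𝟙 (adj n u v) * F u v)
      S : Fin n → Fin n → Fin n → Fin n → ℚ
      S a b c d = δ a c * (w a b * (w c d * (w b d * K a b c d)))
      does-sign : ∀ e → does (sign (lineGraph n) e Sign.≟ Sign.+) ≡ adj n (src e) (tgt e)
      does-sign e with adj n (src e) (tgt e)
      ... | true  = refl
      ... | false = refl
      pointwise : ∀ a b c d → w a b * (w c d * g (edgeAt a b) (edgeAt c d)) ≡ (S a b c d + S a b d c) + (S b a c d + S b a d c)
      pointwise a b c d
        rewrite w-sym b a | w-sym d c | edgeAt-sym b a | edgeAt-sym d c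
        = trans (w-guard a b (λ a≢b → w-guard c d (λ c≢d → trans (sym (ℚ.*-assoc (w (edgeAt a b) (edgeAt c d)) (𝟙 (adj n (edgeAt a b) (edgeAt c d))) (K a b c d)))
          (cong (_* K a b c d) (trans (cong₂ (λ x y → (1ℚ - 𝟙 x) * 𝟙 y) (edgeAt-≟ a≢b c≢d) (adj-edgeAt a≢b c≢d))
            (meeting-weight (pattern! a≢b c≢d)))))))
        (solve 7 (λ p z ac ad bc bd k → p :* (z :* (((ac :* (con 1ℚ :- bd) :+ ad :* (con 1ℚ :- bc)) :+ (bc :* (con 1ℚ :- ad) :+ bd :* (con 1ℚ :- ac))) :* k)) :=
            (ac :* (p :* (z :* ((con 1ℚ :- bd) :* k))) :+ ad :* (p :* (z :* ((con 1ℚ :- bc) :* k)))) :+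
            (bc :* (p :* (z :* ((con 1ℚ :- ad) :* k))) :+ bd :* (p :* (z :* ((con 1ℚ :- ac) :* k))))) refl
          (w a b) (w c d) (δ a c) (δ a d) (δ b c) (δ b d) (K a b c d))
      collapse : ∑₄ S ≡ ∑⁺ K
      collapse = ∑₂-cong (λ a b → trans
        (sum-cong-≗ (λ c → sym (*-distribˡ-sum (δ a c) (λ d → w a b * (w c d * (w b d * K a b c d))))))
        (trans (δ-sum a (λ c → sum (λ d → w a b * (w c d * (w b d * K a b c d)))))
          (sum-cong-≗ (λ d → solve 4 (λ p q r k → p :* (q :* (r :* k)) := (p :* (q :* r)) :* k) refl (w a b) (w a d) (w b d) (K a b a d)))))

  module _ (G : Fin (T n) → Fin (T n) → ℚ) (G-sym : ∀ u v → G u v ≡ G v u) where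

    private
      K : Fin n → Fin n → Fin n → Fin n → ℚ
      K a b c d = G (edgeAt a b) (edgeAt c d)

    -- `G` is left general in order to serve both the indicator of a clustering and the joint
    -- weights of an LP solution.
    obj-lineGraph : (x : Edge (T n) → ℚ) → (∀ e → x e ≡ 1ℚ - G (src e) (tgt e)) →
      obj (lineGraph n) x ≡ ½ * (∑₃ {n} D₃ - ∑⁺ K) + ℤ.+ 1 / 8 * ∑⁻ K
    obj-lineGraph x x≡ = begin
      P + Q                                                ≡⟨ solve 2 (λ p q → p :+ q := con (ℤ.+ 1 / 8) :* (con (ℤ.+ 8 / 1) :* p) :+ con (ℤ.+ 1 / 8) :* (con (ℤ.+ 8 / 1) :* q)) refl P Q ⟩
      ℤ.+ 1 / 8 * ((ℤ.+ 8 / 1) * P) + ℤ.+ 1 / 8 * ((ℤ.+ 8 / 1) * Q)  ≡⟨ cong₂ (λ p q → ℤ.+ 1 / 8 * p + ℤ.+ 1 / 8 * q)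
          (trans (sumOver-E⁺ (λ u v → 1ℚ - G u v) (λ u v → cong (λ y → 1ℚ - y) (G-sym u v)) x x≡) (cong (4ℚ *_)
            (trans (∑₃-cong (λ a b c → solve 2 (λ s k → s :* (con 1ℚ :- k) := s :- s :* k) refl (D₃ a b c) (K a b a c))) (∑₃-sub D₃ (λ a b c → D₃ a b c * K a b a c)))))
          (sumOver-E⁻ G G-sym (λ e → 1ℚ - x e) (λ e → trans (cong (λ y → 1ℚ - y) (x≡ e)) (solve 1 (λ y → con 1ℚ :- (con 1ℚ :- y) := y) refl (G (src e) (tgt e))))) ⟩
      ℤ.+ 1 / 8 * (4ℚ * (∑₃ {n} D₃ - ∑⁺ K)) + ℤ.+ 1 / 8 * ∑⁻ K  ≡⟨ solve 2 (λ p q → con (ℤ.+ 1 / 8) :* (con 4ℚ :* p) :+ q := con ½ :* p :+ q) refl (∑₃ {n} D₃ - ∑⁺ K) (ℤ.+ 1 / 8 * ∑⁻ K) ⟩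
      ½ * (∑₃ {n} D₃ - ∑⁺ K) + ℤ.+ 1 / 8 * ∑⁻ K            ∎
      where
      open ≡-Reasoning
      P Q : ℚ
      P = sumOver (E⁺ (lineGraph n)) x
      Q = sumOver (E⁻ (lineGraph n)) (λ e → 1ℚ - x e)

-- Existence of an optimum clustering

subsets-complete : ∀ (S : Subset n) → S ∈ subsets n
subsets-complete Vec.[] = here refl
subsets-complete {suc n} (outside Vec.∷ S) = ∈-++⁺ˡ (∈-map⁺ (outside Vec.∷_) (subsets-complete S))
subsets-complete {suc n} (inside  Vec.∷ S) = ∈-++⁺ʳ (map (outside Vec.∷_) (subsets n)) (∈-map⁺ (inside Vec.∷_) (subsets-complete S))

subsets-unique : ∀ n → Unique (subsets n)
subsets-unique zero    = [] ∷ []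
subsets-unique (suc n) = Unique.++⁺ (Unique.map⁺ Vec.∷-injectiveʳ (subsets-unique n)) (Unique.map⁺ Vec.∷-injectiveʳ (subsets-unique n)) disj
  where
  disj : ∀ {S} → S ∈ map (outside Vec.∷_) (subsets n) × S ∈ map (inside Vec.∷_) (subsets n) → _
  disj (p , q) with _ , _ , refl ← ∈-map⁻ (outside Vec.∷_) p | _ , _ , () ← ∈-map⁻ (inside Vec.∷_) q

sublists : {A : Set} → List A → List (List A)
sublists []       = [] ∷ []
sublists (x ∷ xs) = sublists xs ++ map (x ∷_) (sublists xs)

filter∈sublists : {A : Set} {P : A → Set} (P? : Decidable P) (xs : List A) → filter P? xs ∈ sublists xs
filter∈sublists P? []       = here refl
filter∈sublists P? (x ∷ xs) with does (P? x)
... | true  = ∈-++⁺ʳ (sublists xs) (∈-map⁺ (x ∷_) (filter∈sublists P? xs))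
... | false = ∈-++⁺ˡ (filter∈sublists P? xs)

allPairs-fromUnique : {A : Set} {R : A → A → Set} {xs : List A} → Unique xs →
  (∀ {x y} → x ∈ xs → y ∈ xs → x ≢ y → R x y) → AllPairs R xs
allPairs-fromUnique []          r = []
allPairs-fromUnique (x∉xs ∷ u) r =
  All.tabulate (λ y∈xs → r (here refl) (there y∈xs) (All.lookup x∉xs y∈xs)) ∷
  allPairs-fromUnique u (λ x∈ y∈ → r (there x∈) (there y∈))

allPairs-lookup : {A : Set} {R : A → A → Set} {xs : List A} → (∀ {x y} → R x y → R y x) → AllPairs R xs →
  ∀ {x y} → x ∈ xs → y ∈ xs → x ≢ y → R x y
allPairs-lookup R-sym (rs ∷ _)  (here refl) (here refl) x≢y = contradiction refl x≢y
allPairs-lookup R-sym (rs ∷ _)  (here refl) (there y∈)  x≢y = All.lookup rs y∈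
allPairs-lookup R-sym (rs ∷ _)  (there x∈)  (here refl) x≢y = R-sym (All.lookup rs x∈)
allPairs-lookup R-sym (_ ∷ rss) (there x∈)  (there y∈)  x≢y = allPairs-lookup R-sym rss x∈ y∈ x≢y

Disjoint : Subset n → Subset n → Set
Disjoint S T = Empty (S ∩ T)

Disjoint-sym : ∀ {S T : Subset n} → Disjoint S T → Disjoint T S
Disjoint-sym {S = S} {T} = subst Empty (∩-comm S T)

IsPartition : List (Subset n) → Set
IsPartition {n} ps = All Nonempty ps × AllPairs Disjoint ps × (∀ (u : Fin n) → Any (u ∈ˢ_) ps)

isPartition? : Decidable (IsPartition {n})
isPartition? ps =
  All.all? nonempty? ps ×-dec (AllPairs.allPairs? (λ S T → ¬? (nonempty? (S ∩ T))) ps ×-dec Fin.all? (λ u → any? (u ∈ˢ?_) ps))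

toClustering : (ps : List (Subset n)) → IsPartition ps → Clustering n
toClustering ps (ne , disj , cov) = record { parts = ps ; nonempty = ne ; disjoint = disj ; covering = cov }

isPartition : (C : Clustering n) → IsPartition (parts C)
isPartition C = nonempty C , disjoint C , covering C

module _ (I : Instance) where

  private
    N : ℕ
    N = vertices I

  -- Defined on bare lists so that `argmin` can range over them; at `parts C` it is `cost I C` by
  -- definition.
  costOf : List (Subset N) → ℕ
  costOf ps = length (filter (λ e → ¬? (any? (e ⊆ᵉ?_) ps)) (E⁺ I)) ℕ.+ length (filter (λ e → any? (e ⊆ᵉ?_) ps) (E⁻ I))

  costOf-cong : ∀ {ps qs} → (∀ {S} → S ∈ ps → S ∈ qs) → (∀ {S} → S ∈ qs → S ∈ ps) → costOf ps ≡ costOf qs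
  costOf-cong {ps} {qs} ps⊆qs qs⊆ps = cong₂ (λ xs ys → length xs ℕ.+ length ys)
    (filter-≐ (λ e → ¬? (any? (e ⊆ᵉ?_) ps)) (λ e → ¬? (any? (e ⊆ᵉ?_) qs)) ((λ {e} ¬p q → ¬p (mono qs⊆ps {e} q)) , (λ {e} ¬q p → ¬q (mono ps⊆qs {e} p))) (E⁺ I))
    (filter-≐ (λ e → any? (e ⊆ᵉ?_) ps) (λ e → any? (e ⊆ᵉ?_) qs) ((λ {e} → mono ps⊆qs {e}) , (λ {e} → mono qs⊆ps {e})) (E⁻ I))
    where
    mono : ∀ {xs ys} → (∀ {S} → S ∈ xs → S ∈ ys) → ∀ {e} → Any (e ⊆ᵉ_) xs → Any (e ⊆ᵉ_) ys
    mono xs⊆ys p with S , S∈xs , e⊆S ← find p = lose (xs⊆ys S∈xs) e⊆S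

  -- Every clustering has the parts of one that occurs among the sublists of
  -- subsets N, so only finitely many clusterings matter.
  module _ (C : Clustering N) where

    open DecMembership (Vec.≡-dec {n = N} Bool._≟_) using (_∈?_)

    canonical : List (Subset N)
    canonical = filter (_∈? parts C) (subsets N)

    canonical⊆parts : ∀ {S} → S ∈ canonical → S ∈ parts C
    canonical⊆parts S∈ = proj₂ (∈-filter⁻ (_∈? parts C) {xs = subsets N} S∈)

    parts⊆canonical : ∀ {S} → S ∈ parts C → S ∈ canonical
    parts⊆canonical S∈ = ∈-filter⁺ (_∈? parts C) (subsets-complete _) S∈

    canonical-isPartition : IsPartition canonical
    canonical-isPartition =
      All.tabulate (λ S∈ → All.lookup (nonempty C) (canonical⊆parts S∈)) ,
      allPairs-fromUnique (Unique.filter⁺ (_∈? parts C) (subsets-unique N))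
        (λ {S} {T} S∈ T∈ → allPairs-lookup (λ {S} {T} → Disjoint-sym {S = S} {T}) (disjoint C) (canonical⊆parts S∈) (canonical⊆parts T∈)) ,
      λ u → let S , S∈ , u∈S = find (covering C u) in lose (parts⊆canonical S∈) u∈S

  isOpt-exists : Clustering N → ∃[ opt ] IsOpt I opt
  isOpt-exists C = costOf best , (toClustering best best-isPartition , refl) , best≤
    where
    candidates : List (List (Subset N))
    candidates = filter isPartition? (sublists (subsets N))
    best : List (Subset N)
    -- `argmin` needs a starting value, and `parts C` is one that is known to be a partition.
    best = argmin costOf (parts C) candidates
    best-isPartition : IsPartition best
    best-isPartition = argmin-all costOf (isPartition C) (all-filter isPartition? (sublists (subsets N)))
    best≤ : ∀ C′ → costOf best ℕ.≤ cost I C′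
    best≤ C′ = f[argmin]≤v⁺ {f = costOf} (parts C) candidates (inj₂ (lose {x = canonical C′}
      (∈-filter⁺ isPartition? (filter∈sublists _ (subsets N)) (canonical-isPartition C′))
      (ℕ.≤-reflexive (costOf-cong (canonical⊆parts C′) (parts⊆canonical C′)))))

-- Joint weights of LP solutions

sumOver-+ : {A : Set} (xs : List A) (f g : A → ℚ) → sumOver xs (λ x → f x + g x) ≡ sumOver xs f + sumOver xs g
sumOver-+ []       f g = refl
sumOver-+ (x ∷ xs) f g = trans (cong ((f x + g x) +_) (sumOver-+ xs f g))
  (solve 4 (λ a b c d → (a :+ b) :+ (c :+ d) := (a :+ c) :+ (b :+ d)) refl (f x) (g x) (sumOver xs f) (sumOver xs g))

sumOver-mono : {A : Set} (xs : List A) {f g : A → ℚ} → (∀ x → f x ≤ g x) → sumOver xs f ≤ sumOver xs g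
sumOver-mono []       f≤g = ℚ.≤-refl
sumOver-mono (x ∷ xs) f≤g = ℚ.+-mono-≤ (f≤g x) (sumOver-mono xs f≤g)

sumOver-zero : {A : Set} (xs : List A) {f : A → ℚ} → (∀ x → f x ≡ 0ℚ) → sumOver xs f ≡ 0ℚ
sumOver-zero []       f≡0 = refl
sumOver-zero (x ∷ xs) f≡0 = cong₂ _+_ (f≡0 x) (sumOver-zero xs f≡0)

sumOver-nonneg : {A : Set} (xs : List A) {f : A → ℚ} → (∀ x → 0ℚ ≤ f x) → 0ℚ ≤ sumOver xs f
sumOver-nonneg []       0≤f = ℚ.≤-refl
sumOver-nonneg (x ∷ xs) 0≤f = 0≤+ (0≤f x) (sumOver-nonneg xs 0≤f)

sumOver-sum : {A : Set} (xs : List A) (f : A → Fin n → ℚ) →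
  sumOver xs (λ x → sum (f x)) ≡ sum (λ i → sumOver xs (λ x → f x i))
sumOver-sum {n} []   f = sym (sum-zero {n} (λ _ → refl))
sumOver-sum (x ∷ xs) f = trans (cong (sum (f x) +_) (sumOver-sum xs f)) (sym (∑-distrib-+ (f x) _))

_≟ˢ_ : (S T : Subset n) → Dec (S ≡ T)
_≟ˢ_ = Vec.≡-dec Bool._≟_

sumOver-subsets-≟ : ∀ (T : Subset n) (f : Subset n → ℚ) →
  sumOver (subsets n) (λ S → 𝟙 (does (S ≟ˢ T)) * f S) ≡ f T
sumOver-subsets-≟ Vec.[] f = trans (ℚ.+-identityʳ _) (ℚ.*-identityˡ (f Vec.[]))
sumOver-subsets-≟ {suc n} (t Vec.∷ T) f =
  trans (sumOver-++ (map (outside Vec.∷_) (subsets n)) (map (inside Vec.∷_) (subsets n)) g)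
    (trans (cong₂ _+_ (sumOver-map (outside Vec.∷_) (subsets n) g) (sumOver-map (inside Vec.∷_) (subsets n) g)) (by-head t))
  where
  g : Subset (suc n) → ℚ
  g S = 𝟙 (does (S ≟ˢ (t Vec.∷ T))) * f S
  by-head : ∀ t → sumOver (subsets n) (λ S → 𝟙 (does ((outside Vec.∷ S) ≟ˢ (t Vec.∷ T))) * f (outside Vec.∷ S)) +
                  sumOver (subsets n) (λ S → 𝟙 (does ((inside Vec.∷ S) ≟ˢ (t Vec.∷ T))) * f (inside Vec.∷ S)) ≡ f (t Vec.∷ T)
  by-head outside = trans (cong₂ _+_ (sumOver-subsets-≟ T (λ S → f (outside Vec.∷ S)))
    (sumOver-zero (subsets n) (λ S → ℚ.*-zeroˡ (f (inside Vec.∷ S))))) (ℚ.+-identityʳ _)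
  by-head inside = trans (cong₂ _+_ (sumOver-zero (subsets n) (λ S → ℚ.*-zeroˡ (f (outside Vec.∷ S))))
    (sumOver-subsets-≟ T (λ S → f (inside Vec.∷ S)))) (ℚ.+-identityˡ _)

-- For a feasible solution this is 1 - x_uv when `u ≢ v`, and 1 on the diagonal. It is thus a
-- symmetric extension of the edge variables to all pairs.
joint : (Subset n → ℚ) → Fin n → Fin n → ℚ
joint {n} z u v = sumOver (filter (λ S → (u ∈ˢ? S) ×-dec (v ∈ˢ? S)) (subsets n)) z

module _ (z : Subset n → ℚ) where

  joint-sumOver : ∀ u v → joint z u v ≡ sumOver (subsets n) (λ S → 𝟙 (does (u ∈ˢ? S) ∧ does (v ∈ˢ? S)) * z S)
  joint-sumOver u v = sumOver-filter (λ S → (u ∈ˢ? S) ×-dec (v ∈ˢ? S)) (subsets n) z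

  joint-sym : ∀ u v → joint z u v ≡ joint z v u
  joint-sym u v = trans (joint-sumOver u v) (trans (sumOver-cong (subsets n)
    (λ S → cong (λ b → 𝟙 b * z S) (Bool.∧-comm (does (u ∈ˢ? S)) (does (v ∈ˢ? S))))) (sym (joint-sumOver v u)))

  joint-diag : ∀ u → joint z u u ≡ sumOver (filter (u ∈ˢ?_) (subsets n)) z
  joint-diag u = trans (joint-sumOver u u) (trans (sumOver-cong (subsets n)
    (λ S → cong (λ b → 𝟙 b * z S) (Bool.∧-idem (does (u ∈ˢ? S))))) (sym (sumOver-filter (u ∈ˢ?_) (subsets n) z)))

  module _ (0≤z : ∀ S → Nonempty S → 0ℚ ≤ z S) where

    joint-nonneg : ∀ u v → 0ℚ ≤ joint z u v
    joint-nonneg u v = subst (0ℚ ≤_) (sym (joint-sumOver u v)) (sumOver-nonneg (subsets n) pointwise)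
      where
      pointwise : ∀ S → 0ℚ ≤ 𝟙 (does (u ∈ˢ? S) ∧ does (v ∈ˢ? S)) * z S
      pointwise S with u ∈ˢ? S
      ... | yes u∈S = 0≤* (0≤𝟙 (does (v ∈ˢ? S))) (0≤z S (u , u∈S))
      ... | no _    = ℚ.≤-reflexive (sym (ℚ.*-zeroˡ (z S)))

    -- True for each set separately: if one term on the left counts `S`, then `v` is in `S`; if both
    -- do, then so are `u` and `w`.
    joint-triangle : ∀ u v w → joint z u v + joint z v w ≤ joint z v v + joint z u w
    joint-triangle u v w = subst₂ _≤_
        (trans (sumOver-+ (subsets n) (term u v) (term v w)) (sym (cong₂ _+_ (joint-sumOver u v) (joint-sumOver v w))))
        (trans (sumOver-+ (subsets n) (term v v) (term u w)) (sym (cong₂ _+_ (joint-sumOver v v) (joint-sumOver u w))))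
        (sumOver-mono (subsets n) pointwise)
      where
      both term : Fin n → Fin n → Subset n → ℚ
      both i j S = 𝟙 (does (i ∈ˢ? S) ∧ does (j ∈ˢ? S))
      term i j S = both i j S * z S
      slack : ∀ x y z → 𝟙 (x ∧ y) + 𝟙 (y ∧ z) ≤ 𝟙 (y ∧ y) + 𝟙 (x ∧ z)
      slack true  true  true  = toWitness {a? = _ ℚ.≤? _} _
      slack true  true  false = toWitness {a? = _ ℚ.≤? _} _
      slack true  false true  = toWitness {a? = _ ℚ.≤? _} _
      slack true  false false = toWitness {a? = _ ℚ.≤? _} _
      slack false true  true  = toWitness {a? = _ ℚ.≤? _} _
      slack false true  false = toWitness {a? = _ ℚ.≤? _} _
      slack false false true  = toWitness {a? = _ ℚ.≤? _} _
      slack false false false = toWitness {a? = _ ℚ.≤? _} _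
      pointwise : ∀ S → term u v S + term v w S ≤ term v v S + term u w S
      pointwise S with nonempty? S
      ... | yes ne = subst₂ _≤_ (ℚ.*-distribʳ-+ (z S) (both u v S) (both v w S)) (ℚ.*-distribʳ-+ (z S) (both v v S) (both u w S))
            (ℚ.*-monoʳ-≤-nonNeg (z S) {{nonNegative (0≤z S ne)}} (slack (does (u ∈ˢ? S)) (does (v ∈ˢ? S)) (does (w ∈ˢ? S))))
      -- The dummy `z` at the empty set may be negative, but all its indicators vanish.
      ... | no ¬ne rewrite dec-false (u ∈ˢ? S) (λ p → ¬ne (u , p)) | dec-false (v ∈ˢ? S) (λ p → ¬ne (v , p)) = ℚ.≤-refl

-- The half-weighted stars

ends-distinct : ∀ n (u : Fin (T n)) → proj₁ (ends n u) ≢ proj₂ (ends n u)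
ends-distinct (suc n) u with splitAt n u
... | inj₁ b  = λ ()
... | inj₂ u′ = λ eq → ends-distinct n u′ (suc-injective eq)

star : ∀ n → Fin n → Subset (T n)
star n a = Vec.tabulate (λ u → does (a ∈ₑ? ends n u))

does-∈? : ∀ (u : Fin n) (S : Subset n) → does (u ∈ˢ? S) ≡ Vec.lookup S u
does-∈? zero    (inside  Vec.∷ S) = refl
does-∈? zero    (outside Vec.∷ S) = refl
does-∈? (suc u) (_ Vec.∷ S)       = does-∈? u S

∈star : ∀ n (u : Fin (T n)) a → does (u ∈ˢ? star n a) ≡ does (a ∈ₑ? ends n u)
∈star n u a = trans (does-∈? u (star n a)) (Vec.lookup∘tabulate (λ u → does (a ∈ₑ? ends n u)) u)

-- The sum over centres counts coinciding stars with multiplicity: for `n = 2` both stars are the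
-- same set, which must get weight 1.
half-stars : ∀ n → Subset (T n) → ℚ
half-stars n S = ½ * sum (λ a → 𝟙 (does (S ≟ˢ star n a)))

sumOver-half-stars : ∀ n {P : Subset (T n) → Set} (P? : Decidable P) →
  sumOver (filter P? (subsets (T n))) (half-stars n) ≡ ½ * sum (λ a → 𝟙 (does (P? (star n a))))
sumOver-half-stars n P? = begin
  sumOver (filter P? (subsets (T n))) (half-stars n)
    ≡⟨ sumOver-filter P? (subsets (T n)) (half-stars n) ⟩
  sumOver (subsets (T n)) (λ S → p S * (½ * sum (λ a → e S a)))
    ≡⟨ sumOver-cong (subsets (T n)) (λ S → trans (solve 3 (λ x y z → x :* (y :* z) := (y :* x) :* z) refl (p S) ½ (sum (e S)))
         (trans (*-distribˡ-sum (½ * p S) (e S)) (sum-cong-≗ (λ a → ℚ.*-comm (½ * p S) (e S a))))) ⟩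
  sumOver (subsets (T n)) (λ S → sum (λ a → e S a * (½ * p S)))
    ≡⟨ sumOver-sum (subsets (T n)) (λ S a → e S a * (½ * p S)) ⟩
  sum (λ a → sumOver (subsets (T n)) (λ S → e S a * (½ * p S)))
    ≡⟨ sum-cong-≗ (λ a → sumOver-subsets-≟ (star n a) (λ S → ½ * p S)) ⟩
  sum (λ a → ½ * p (star n a))
    ≡⟨ *-distribˡ-sum ½ (λ a → p (star n a)) ⟨
  ½ * sum (λ a → p (star n a)) ∎
  where
  open ≡-Reasoning
  p : Subset (T n) → ℚ
  p S = 𝟙 (does (P? S))
  e : Subset (T n) → Fin n → ℚ
  e S a = 𝟙 (does (S ≟ˢ star n a))

𝟙-∨ : ∀ x {a b : Fin n} → a ≢ b → 𝟙 (does (x ≟ a) ∨ does (x ≟ b)) ≡ δ a x + δ b x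
𝟙-∨ x {a} {b} a≢b rewrite δ-sym a x | δ-sym b x with x ≟ a | x ≟ b
... | yes refl | yes refl = contradiction refl a≢b
... | yes _    | no _     = refl
... | no _     | yes _    = refl
... | no _     | no _     = refl

-- An edge lies in exactly two stars, those centred at its endpoints.
half-stars-vertex : ∀ n u → sumOver (filter (u ∈ˢ?_) (subsets (T n))) (half-stars n) ≡ 1ℚ
half-stars-vertex n u = trans (sumOver-half-stars n (u ∈ˢ?_)) (cong (½ *_) (begin
  sum (λ a → 𝟙 (does (u ∈ˢ? star n a)))  ≡⟨ sum-cong-≗ (λ a → trans (cong 𝟙 (∈star n u a)) (𝟙-∨ a (ends-distinct n u))) ⟩
  sum (λ a → δ p a + δ q a)              ≡⟨ ∑-distrib-+ (δ p) (δ q) ⟩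
  sum (δ p) + sum (δ q)                  ≡⟨ cong₂ _+_ (sum-δ p) (sum-δ q) ⟩
  2ℚ                                     ∎))
  where
  open ≡-Reasoning
  p q : Fin n
  p = proj₁ (ends n u)
  q = proj₂ (ends n u)

-- Clusterings as 0/1 solutions

does≡true⇒ : {P : Set} (P? : Dec P) → does P? ≡ true → P
does≡true⇒ (yes p) _ = p

same : Clustering n → Fin n → Fin n → Bool
same C u v = does (any? (λ S → (u ∈ˢ? S) ×-dec (v ∈ˢ? S)) (parts C))

same-sym : ∀ (C : Clustering n) u v → same C u v ≡ same C v u
same-sym C u v = does-⇔ (mk⇔ (Any.map Product.swap) (Any.map Product.swap)) (any? _ (parts C)) (any? _ (parts C))

-- Parts with the common element `v` coincide, by disjointness.
same-trans : ∀ (C : Clustering n) u v w → same C u v ≡ true → same C v w ≡ true → same C u w ≡ true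
same-trans C u v w uv vw
  with find (does≡true⇒ (any? (λ S → (u ∈ˢ? S) ×-dec (v ∈ˢ? S)) (parts C)) uv)
     | find (does≡true⇒ (any? (λ S → (v ∈ˢ? S) ×-dec (w ∈ˢ? S)) (parts C)) vw)
... | S , S∈C , u∈S , v∈S | S′ , S′∈C , v∈S′ , w∈S′ with S ≟ˢ S′
...   | yes refl = dec-true (any? _ (parts C)) (lose S∈C (u∈S , w∈S′))
...   | no S≢S′  = contradiction (v , x∈p∩q⁺ (v∈S , v∈S′))
        (allPairs-lookup (λ {S} {T} → Disjoint-sym {S = S} {T}) (disjoint C) S∈C S′∈C S≢S′)

fromℕ : ℕ → ℚ
fromℕ m = ℤ.+ m / 1

-- `_/_` divides by a gcd that is stuck for a variable `m`; from the normal form on, arithmetic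
-- computes.
fromℕ-mkℚ : ∀ m → fromℕ m ≡ mkℚ (ℤ.+ m) 0 (Coprimality.sym (Coprimality.1-coprimeTo m))
fromℕ-mkℚ m = ℚ.normalize-coprime (Coprimality.sym (Coprimality.1-coprimeTo m))

fromℕ-+ : ∀ l m → fromℕ (l ℕ.+ m) ≡ fromℕ l + fromℕ m
fromℕ-+ l m = sym (trans (cong₂ _+_ (fromℕ-mkℚ l) (fromℕ-mkℚ m))
  (cong (_/ 1) (cong₂ ℤ._+_ (ℤ.*-identityʳ (ℤ.+ l)) (ℤ.*-identityʳ (ℤ.+ m)))))

fromℕ-length : {A : Set} (xs : List A) → fromℕ (length xs) ≡ sumOver xs (λ _ → 1ℚ)
fromℕ-length []       = refl
fromℕ-length (x ∷ xs) = trans (fromℕ-+ 1 (length xs)) (cong (1ℚ +_) (fromℕ-length xs))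

cost-obj : (I : Instance) (C : Clustering (vertices I)) →
  fromℕ (cost I C) ≡ obj I (λ e → 1ℚ - 𝟙 (same C (src e) (tgt e)))
cost-obj I C = trans (fromℕ-+ (length (filter (λ e → ¬? (samePart? C e)) (E⁺ I))) _) (cong₂ _+_
  (trans (fromℕ-length (filter (λ e → ¬? (samePart? C e)) (E⁺ I))) (trans (sumOver-filter (λ e → ¬? (samePart? C e)) (E⁺ I) (λ _ → 1ℚ))
    (sumOver-cong (E⁺ I) (λ e → cut (same C (src e) (tgt e))))))
  (trans (fromℕ-length (filter (samePart? C) (E⁻ I))) (trans (sumOver-filter (samePart? C) (E⁻ I) (λ _ → 1ℚ))
    (sumOver-cong (E⁻ I) (λ e → joined (same C (src e) (tgt e)))))))
  where
  cut : ∀ b → 𝟙 (not b) * 1ℚ ≡ 1ℚ - 𝟙 b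
  cut true  = refl
  cut false = refl
  joined : ∀ b → 𝟙 b * 1ℚ ≡ 1ℚ - (1ℚ - 𝟙 b)
  joined true  = refl
  joined false = refl

-- The two bounds applied to the line graph

module _ (e₀ : Fin (T n)) where

  private
    ⟨_,_⟩ : Fin n → Fin n → Fin (T n)
    ⟨ a , b ⟩ = edgeAt e₀ a b

    K-swap : {A : Set} (G : Fin (T n) → Fin (T n) → A) → ∀ a b c d → G ⟨ b , a ⟩ ⟨ c , d ⟩ ≡ G ⟨ a , b ⟩ ⟨ c , d ⟩
    K-swap G a b c d = cong (λ u → G u ⟨ c , d ⟩) (edgeAt-sym e₀ b a)

  cost-bound : ∀ (C : Clustering (T n)) → ℤ.+ 1 / 3 * ∑₃ {n} D₃ - ½ * ∑₂ {n} w ≤ fromℕ (cost (lineGraph n) C)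
  cost-bound C = subst (ℤ.+ 1 / 3 * ∑₃ {n} D₃ - ½ * ∑₂ {n} w ≤_)
    (sym (trans (cost-obj (lineGraph n) C)
      (obj-lineGraph e₀ (λ u v → 𝟙 (same C u v)) (λ u v → cong 𝟙 (same-sym C u v)) _ (λ _ → refl))))
    (integral-bound (λ a b c d → same C ⟨ a , b ⟩ ⟨ c , d ⟩)
      (K-swap (same C))
      (λ a b c d → same-sym C ⟨ c , d ⟩ ⟨ a , b ⟩)
      (λ a b c d e f → same-trans C ⟨ a , b ⟩ ⟨ c , d ⟩ ⟨ e , f ⟩))

  private
    G : Fin (T n) → Fin (T n) → ℚ
    G = joint (half-stars n)
    K : Fin n → Fin n → Fin n → Fin n → ℚ
    K a b c d = G ⟨ a , b ⟩ ⟨ c , d ⟩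

    -- The stars containing two given edges are centred at their common endpoints, so `K` is half
    -- the number of these.
    G-sum : ∀ {a b c d} → a ≢ b → c ≢ d →
      K a b c d ≡ ½ * sum (λ x → 𝟙 ((does (x ≟ a) ∨ does (x ≟ b)) ∧ (does (x ≟ c) ∨ does (x ≟ d))))
    G-sum {a} {b} {c} {d} a≢b c≢d = trans (sumOver-half-stars n (λ S → (⟨ a , b ⟩ ∈ˢ? S) ×-dec (⟨ c , d ⟩ ∈ˢ? S)))
      (cong (½ *_) (sum-cong-≗ (λ x → cong 𝟙 (cong₂ _∧_
        (trans (∈star n ⟨ a , b ⟩ x) (∈ₑ-ends e₀ x a≢b)) (trans (∈star n ⟨ c , d ⟩ x) (∈ₑ-ends e₀ x c≢d))))))

    K-meeting : ∀ {a b c} → a ≢ b → a ≢ c → b ≢ c → K a b a c ≡ ½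
    K-meeting {a} {b} {c} a≢b a≢c b≢c = trans (G-sum a≢b a≢c)
      (cong (½ *_) (trans (sum-cong-≗ pointwise) (sum-δ a)))
      where
      pointwise : ∀ x → 𝟙 ((does (x ≟ a) ∨ does (x ≟ b)) ∧ (does (x ≟ a) ∨ does (x ≟ c))) ≡ δ a x
      pointwise x rewrite δ-sym a x with x ≟ a | x ≟ b | x ≟ c
      ... | yes _ | _ | _ = refl
      ... | no _  | yes refl | yes refl = contradiction refl b≢c
      ... | no _  | yes _    | no _     = refl
      ... | no _  | no _     | _        = refl

    K-disjoint : ∀ {a b c d} → a ≢ b → a ≢ c → a ≢ d → b ≢ c → b ≢ d → c ≢ d → K a b c d ≡ 0ℚ
    K-disjoint {a} {b} {c} {d} a≢b a≢c a≢d b≢c b≢d c≢d = trans (G-sum a≢b c≢d)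
      (cong (½ *_) (sum-zero pointwise))
      where
      pointwise : ∀ x → 𝟙 ((does (x ≟ a) ∨ does (x ≟ b)) ∧ (does (x ≟ c) ∨ does (x ≟ d))) ≡ 0ℚ
      pointwise x with x ≟ a | x ≟ b | x ≟ c | x ≟ d
      ... | no _     | no _     | _        | _        = refl
      ... | yes _    | _        | no _     | no _     = refl
      ... | no _     | yes _    | no _     | no _     = refl
      ... | yes refl | _        | yes refl | _        = contradiction refl a≢c
      ... | yes refl | _        | no _     | yes refl = contradiction refl a≢d
      ... | no _     | yes refl | yes refl | _        = contradiction refl b≢c
      ... | no _     | yes refl | no _     | yes refl = contradiction refl b≢d

    ∑⁺K : ∑⁺ K ≡ ½ * ∑₃ {n} D₃
    ∑⁺K = trans (∑₃-cong pointwise) (∑₃-* ½ D₃)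
      where
      pointwise : ∀ a b c → D₃ a b c * K a b a c ≡ ½ * D₃ a b c
      pointwise a b c = trans (reassoc (K a b a c)) (trans
        (w-guard a b (λ a≢b → w-guard a c (λ a≢c → w-guard b c (λ b≢c → K-meeting a≢b a≢c b≢c))))
        (trans (sym (reassoc ½)) (ℚ.*-comm (D₃ a b c) ½)))
        where
        reassoc : ∀ k → D₃ a b c * k ≡ w a b * (w a c * (w b c * k))
        reassoc = solve 4 (λ p q r k → (p :* (q :* r)) :* k := p :* (q :* (r :* k))) refl (w a b) (w a c) (w b c)

    ∑⁻K : ∑⁻ K ≡ 0ℚ
    ∑⁻K = sum-zero (λ a → sum-zero (λ b → sum-zero (λ c → sum-zero (λ d → pointwise a b c d))))
      where
      pointwise : ∀ a b c d → D₄ a b c d * K a b c d ≡ 0ℚ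
      pointwise a b c d = trans (reassoc (K a b c d)) (trans
        (w-guard a b (λ a≢b → w-guard a c (λ a≢c → w-guard b c (λ b≢c →
          w-guard a d (λ a≢d → w-guard b d (λ b≢d → w-guard c d (λ c≢d → K-disjoint a≢b a≢c a≢d b≢c b≢d c≢d)))))))
        (trans (sym (reassoc 0ℚ)) (ℚ.*-zeroʳ (D₄ a b c d))))
        where
        reassoc : ∀ k → D₄ a b c d * k ≡ w a b * (w a c * (w b c * (w a d * (w b d * (w c d * k)))))
        reassoc = solve 7 (λ p q r x y z k → ((p :* (q :* r)) :* (x :* (y :* z))) :* k := p :* (q :* (r :* (x :* (y :* (z :* k)))))) refl
          (w a b) (w a c) (w b c) (w a d) (w b d) (w c d)

  isClusterLPOptimum : 2ℚ ≤ ν n - 3ℚ → IsClusterLPOptimum (lineGraph n) (ℤ.+ 1 / 4 * ∑₃ {n} D₃)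
  isClusterLPOptimum 2≤ν-3 = (half-stars n , (λ e → 1ℚ - G (src e) (tgt e)) , feasible , attained) , optimal
    where
    feasible : ClusterLPFeasible (T n) (half-stars n) (λ e → 1ℚ - G (src e) (tgt e))
    feasible = record
      { vertexConstraint = half-stars-vertex n
      ; edgeConstraint   = λ e → solve 1 (λ y → y := con 1ℚ :- (con 1ℚ :- y)) refl (G (src e) (tgt e))
      ; nonnegative      = λ S _ → 0≤* {½} (ℚ.nonNegative⁻¹ ½) (sum-nonneg (λ a → 0≤𝟙 (does (S ≟ˢ star n a))))
      }
    attained : obj (lineGraph n) (λ e → 1ℚ - G (src e) (tgt e)) ≡ ℤ.+ 1 / 4 * ∑₃ {n} D₃
    attained = trans (obj-lineGraph e₀ G (joint-sym (half-stars n)) _ (λ _ → refl))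
      (trans (cong₂ (λ p q → ½ * (∑₃ {n} D₃ - p) + ℤ.+ 1 / 8 * q) ∑⁺K ∑⁻K)
        (solve 1 (λ s → con ½ :* (s :- con ½ :* s) :+ con (ℤ.+ 1 / 8) :* con 0ℚ := con (ℤ.+ 1 / 4) :* s) refl (∑₃ {n} D₃)))
    optimal : ∀ z x → ClusterLPFeasible (T n) z x → ℤ.+ 1 / 4 * ∑₃ {n} D₃ ≤ obj (lineGraph n) x
    optimal z x feas = subst (ℤ.+ 1 / 4 * ∑₃ {n} D₃ ≤_)
        (sym (obj-lineGraph e₀ H (joint-sym z) x x≡))
        -- The objective exceeds `1/4 * ∑₃ D₃` by exactly a quarter of the slack in `bound`.
        (≤-by _ (0≤* {ℤ.+ 1 / 4} (ℚ.nonNegative⁻¹ (ℤ.+ 1 / 4)) (0≤- bound))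
          (solve 3 (λ s p q → con (ℤ.+ 1 / 4) :* s :+ con (ℤ.+ 1 / 4) :* ((s :+ con ½ :* q) :- con 2ℚ :* p) :=
             con ½ :* (s :- p) :+ con (ℤ.+ 1 / 8) :* q) refl (∑₃ {n} D₃) (∑⁺ L) (∑⁻ L)))
      where
      open ClusterLPFeasible feas
      H : Fin (T n) → Fin (T n) → ℚ
      H = joint z
      L : Fin n → Fin n → Fin n → Fin n → ℚ
      L a b c d = H ⟨ a , b ⟩ ⟨ c , d ⟩
      x≡ : ∀ e → x e ≡ 1ℚ - H (src e) (tgt e)
      x≡ e = trans (solve 1 (λ y → y := con 1ℚ :- (con 1ℚ :- y)) refl (x e)) (cong (λ y → 1ℚ - y) (sym (edgeConstraint e)))
      bound : 2ℚ * ∑⁺ L ≤ ∑₃ {n} D₃ + ½ * ∑⁻ L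
      bound = fractional-bound L (K-swap H) (λ a b c d → joint-sym z ⟨ c , d ⟩ ⟨ a , b ⟩) 2≤ν-3
        (λ a b c d → joint-nonneg z nonnegative ⟨ a , b ⟩ ⟨ c , d ⟩)
        -- The bad triangle inequality holds for any three vertices of the instance, also for tuples
        -- where `edgeAt` returns junk; the 1 is the total weight of the sets containing bc.
        (λ a b c d → subst (λ y → L a b b c + L b c c d ≤ y + L a b c d)
          (trans (joint-diag z ⟨ b , c ⟩) (vertexConstraint ⟨ b , c ⟩))
          (joint-triangle z nonnegative ⟨ a , b ⟩ ⟨ b , c ⟩ ⟨ c , d ⟩))

-- The choice of `n`

ν≡fromℕ : ∀ n → ν n ≡ fromℕ n
ν≡fromℕ zero    = sum-zero {zero} (λ ())
ν≡fromℕ (suc n) = trans (sum-suc (λ _ → 1ℚ)) (trans (cong (1ℚ +_) (ν≡fromℕ n)) (sym (fromℕ-+ 1 n)))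

0≤fromℕ : ∀ m → 0ℚ ≤ fromℕ m
0≤fromℕ m = subst (0ℚ ≤_) (ν≡fromℕ m) (sum-nonneg {m} (λ _ → ℚ.nonNegative⁻¹ 1ℚ))

-- The denominator of `ε` is a suitable multiplier: the product is the numerator, a positive
-- integer.
archimedean : ∀ {ε} → 0ℚ < ε → ∃[ d ] 1ℚ ≤ fromℕ (suc d) * ε
archimedean {mkℚ ℤ.+[1+ k ] d c} _ = d , subst (λ q → 1ℚ ≤ q * mkℚ ℤ.+[1+ k ] d c) (sym (fromℕ-mkℚ (suc d)))
  (subst (_≤ q * mkℚ ℤ.+[1+ k ] d c) (ℚ.*-inverseʳ q)
    (*-monoˡ {q} {1/ q} {mkℚ ℤ.+[1+ k ] d c} (ℚ.nonNegative⁻¹ q) (*≤* (ℤ.*-monoʳ-≤-nonNeg (ℤ.+ suc d) {ℤ.+ 1} {ℤ.+[1+ k ]} (ℤ.+≤+ (s≤s z≤n))))))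
  where
  q : ℚ
  q = mkℚ (ℤ.+ suc d) 0 (Coprimality.sym (Coprimality.1-coprimeTo (suc d)))
archimedean {mkℚ (ℤ.+ 0)    d c} (*<* (ℤ.+<+ ()))
archimedean {mkℚ ℤ.-[1+ k ] d c} (*<* ())

oneCluster : Fin n → Clustering n
oneCluster u₀ = record
  { parts    = ⊤ ∷ []
  ; nonempty = (u₀ , ∈⊤) ∷ []
  ; disjoint = [] ∷ []
  ; covering = λ u → here ∈⊤
  }

ν-quadruple : ∀ d → ν (2 ℕ.+ d ℕ.* 4) ≡ 2ℚ + 4ℚ * fromℕ d
ν-quadruple d = trans (ν≡fromℕ (2 ℕ.+ d ℕ.* 4)) (trans (fromℕ-+ 2 (d ℕ.* 4)) (cong (2ℚ +_) (quadruple d)))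
  where
  quadruple : ∀ d → fromℕ (d ℕ.* 4) ≡ 4ℚ * fromℕ d
  quadruple zero    = refl
  quadruple (suc d) = trans (fromℕ-+ 4 (d ℕ.* 4)) (trans (cong (4ℚ +_) (quadruple d))
    (trans (solve 1 (λ x → con 4ℚ :+ con 4ℚ :* x := con 4ℚ :* (con 1ℚ :+ x)) refl (fromℕ d)) (cong (4ℚ *_) (sym (fromℕ-+ 1 d)))))

-- With `n = 4 q + 2` the factor `n - 2` is `4 q`, so the LP optimum is `q * W` and every clustering
-- costs at least `(4/3 * q - ½) * W`. The loss `½ * W` is at most `ε * (q * W)` as soon as
-- `q * ε ≥ ½`. The bound `q ≥ 1` gives `n ≥ 6`, enough for the fractional bound and for a positive
-- optimum.
gap : ∀ ε n q → Fin (T n) → ν n ≡ 2ℚ + 4ℚ * q → 1ℚ ≤ q → 1ℚ ≤ q * ε → ∃[ I ] ∃[ opt ] ∃[ LP* ]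
  IsOpt I opt × IsClusterLPOptimum I LP* × 0ℚ < LP* × (ℤ.+ 4 / 3 - ε) * LP* ≤ fromℕ opt
gap ε n q e₀ ν≡ 1≤q 1≤qε with isOpt-exists (lineGraph n) (oneCluster e₀)
... | opt , isOpt@((C , cost≡opt) , _) =
  lineGraph n , opt , ℤ.+ 1 / 4 * ∑₃ {n} D₃ , isOpt , isClusterLPOptimum e₀ 2≤ν-3 , 0<LP* ,
  ℚ.≤-trans ratio (subst (λ m → ℤ.+ 1 / 3 * ∑₃ {n} D₃ - ½ * W ≤ fromℕ m) cost≡opt (cost-bound e₀ C))
  where
  W : ℚ
  W = ∑₂ {n} w
  0≤q-1 : 0ℚ ≤ q - 1ℚ
  0≤q-1 = 0≤- 1≤q
  2≤ν-3 : 2ℚ ≤ ν n - 3ℚ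
  2≤ν-3 = subst (λ x → 2ℚ ≤ x - 3ℚ) (sym ν≡) (≤-by _ (0≤+ (ℚ.nonNegative⁻¹ 1ℚ) (0≤* {4ℚ} (ℚ.nonNegative⁻¹ 4ℚ) 0≤q-1))
    (solve 1 (λ x → con 2ℚ :+ (con 1ℚ :+ con 4ℚ :* (x :- con 1ℚ)) := (con 2ℚ :+ con 4ℚ :* x) :- con 3ℚ) refl q))
  W≡ : W ≡ (2ℚ + 4ℚ * q) * ((2ℚ + 4ℚ * q) - 1ℚ)
  W≡ = trans ∑₂w (cong (λ x → x * (x - 1ℚ)) ν≡)
  D≡ : ∑₃ {n} D₃ ≡ 4ℚ * q * W
  D≡ = trans ∑₃D₃ (cong₂ _*_ (trans (cong (_- 2ℚ) ν≡) (solve 1 (λ x → (con 2ℚ :+ con 4ℚ :* x) :- con 2ℚ := con 4ℚ :* x) refl q)) (sym ∑₂w))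
  0≤W : 0ℚ ≤ W
  0≤W = sum-nonneg (λ a → sum-nonneg (λ b → 0≤w a b))
  -- ∑₃ D₃ / 4 = q (4q + 2) (4q + 1), expanded in powers of q - 1.
  0<LP* : 0ℚ < ℤ.+ 1 / 4 * ∑₃ {n} D₃
  0<LP* = ℚ.<-≤-trans (ℚ.positive⁻¹ 1ℚ) (≤-by _
      (0≤+ (ℚ.nonNegative⁻¹ (ℤ.+ 29 / 1)) (0≤* 0≤q-1 (0≤+ (ℚ.nonNegative⁻¹ (ℤ.+ 74 / 1)) (0≤* 0≤q-1
        (0≤+ (ℚ.nonNegative⁻¹ (ℤ.+ 60 / 1)) (0≤* {ℤ.+ 16 / 1} (ℚ.nonNegative⁻¹ (ℤ.+ 16 / 1)) 0≤q-1))))))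
      (trans (solve 1 (λ x → let r = x :- con 1ℚ in
          con 1ℚ :+ (con (ℤ.+ 29 / 1) :+ r :* (con (ℤ.+ 74 / 1) :+ r :* (con (ℤ.+ 60 / 1) :+ con (ℤ.+ 16 / 1) :* r))) :=
          con (ℤ.+ 1 / 4) :* (con 4ℚ :* x :* ((con 2ℚ :+ con 4ℚ :* x) :* ((con 2ℚ :+ con 4ℚ :* x) :- con 1ℚ)))) refl q)
        (cong (ℤ.+ 1 / 4 *_) (sym (trans D≡ (cong (4ℚ * q *_) W≡))))))
  ratio : (ℤ.+ 4 / 3 - ε) * (ℤ.+ 1 / 4 * ∑₃ {n} D₃) ≤ ℤ.+ 1 / 3 * ∑₃ {n} D₃ - ½ * W
  ratio = subst (λ D → (ℤ.+ 4 / 3 - ε) * (ℤ.+ 1 / 4 * D) ≤ ℤ.+ 1 / 3 * D - ½ * W) (sym D≡)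
    (≤-by _ (0≤+ (0≤* (0≤- 1≤qε) 0≤W) (0≤* {½} (ℚ.nonNegative⁻¹ ½) 0≤W))
      (solve 3 (λ e x y → (con (ℤ.+ 4 / 3) :- e) :* (con (ℤ.+ 1 / 4) :* (con 4ℚ :* x :* y)) :+ ((x :* e :- con 1ℚ) :* y :+ con ½ :* y) :=
         con (ℤ.+ 1 / 3) :* (con 4ℚ :* x :* y) :- con ½ :* y) refl ε q W))

open import Data.Integer.Base using (+_)

theorem4 : (ε : ℚ) → 0ℚ < ε →
    ∃[ I ] ∃[ opt ] ∃[ LP* ]
    IsOpt I opt × IsClusterLPOptimum I LP* × 0ℚ < LP* ×
    (+ opt / 1) ≥ ((+ 4 / 3) - ε) * LP*
theorem4 ε 0<ε = let d , 1≤qε = archimedean 0<ε in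
  gap ε (2 ℕ.+ suc d ℕ.* 4) (fromℕ (suc d)) zero (ν-quadruple (suc d))
    (≤-by _ (0≤fromℕ d) (sym (fromℕ-+ 1 d))) 1≤qε
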